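{- There is an absolute constant $C>0$ such that the following holds. For any $\epsilon>0$, $\delta\in(0,1)$, $n\in\mathbb{N}$, and any integer $k\ge C\epsilon^{ -2}\delta^{ -1}$, and for any insertion-only stream over $[n]$ with frequencies $f^{(1)},f^{(2)},\dots,f^{(m)}$, the CountSketch algorithm with $k$ rows provides $\ell_2$ $(\epsilon,\delta)$-weak tracking; that is, $$\Pr_{\Pi}\left[\exists\, t\in[m]:\ \Bigl|\|\Pi f^{(t)}\|_2^2-\|f^{(t)}\|_2^2\Bigr|>\epsilon\|f^{(m)}\|_2^2\right]\le\delta,$$ where $\Pi\in\mathbb{R}^{k\times n}$ is the random CountSketch matrix.
   Context: $[n]=\{1,\dots,n\}$. An insertion-only stream over $[n]$ of length $m$ is a fixed list $a_1,\dots,a_m\in[n]$; its frequency vector at time $t\in[m]$ is $f^{(t)}\in\mathbb{R}^n$ with $f^{(t)}_i=|\{1\le j\le t: a_j=i\}|$. The CountSketch matrix with $k$ rows is the random matrix $\Pi\in\mathbb{R}^{k\times n}$ whose columns are generated independently as follows: for each $i\in[n]$, pick $j\in[k]$ uniformly at random, set $\Pi_{j,i}$ to be an independent Rademacher ($\pm1$ with probability $1/2$ each) random variable, and set all other entries of the $i$-th column to $0$. The algorithm maintains $\tilde f^{(t)}=\Pi f^{(t)}$ and outputs $\|\tilde f^{(t)}\|_2^2$ at time $t$. -}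

module Defs where

open import Level using (0ℓ)
open import Data.Bool using (if_then_else_)
open import Data.Fin using (Fin; _≟_)
open import Data.Integer as ℤ using (ℤ; +_; _◃_; 0ℤ)
import Data.Integer.Properties as ℤ
open import Data.List
  using (List; []; _∷_; allFin; cartesianProduct; cartesianProductWith; filter; length; take)
open import Data.Nat as ℕ using (ℕ; zero; suc; NonZero)
import Data.Nat.Properties as ℕ
open import Data.Product using (_×_; _,_; ∃-syntax; proj₁; proj₂)
open import Data.Rational as ℚ using (ℚ; 0ℚ; 1ℚ; ∣_∣)
import Data.Rational.Properties as ℚ
open import Data.Rational.Solver using (module +-*-Solver)
open import Data.Sign using (Sign)
open import Data.Vec using (Vec; []; _∷_; lookup)
open import Relation.Binary.PropositionalEquality using (_≡_; refl; sym; trans; cong; cong₂; subst)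
open import Relation.Nullary using (¬_; does)
open import Relation.Unary using (Pred; Decidable; _⊆_)
open import Algebra.Properties.CommutativeMonoid.Sum ℤ.+-0-commutativeMonoid using (sum)

-- Real numbers are Cauchy sequences of rationals.  No equality on ℝ is needed
-- below; the order does not distinguish sequences with the same limit.

Cauchy : (ℕ → ℚ) → Set
Cauchy x = ∀ q → 0ℚ ℚ.< q →
  ∃[ N ] (∀ i j → N ℕ.≤ i → N ℕ.≤ j → ∣ x i ℚ.- x j ∣ ℚ.< q)

record ℝ : Set where
  constructor mkℝ
  field
    seq    : ℕ → ℚ
    cauchy : Cauchy seq

open ℝ public

infix 4 _<ᵣ_ _≤ᵣ_
infixl 7 _*ᵣ_

_<ᵣ_ : ℝ → ℝ → Set
x <ᵣ y = ∃[ q ] (0ℚ ℚ.< q × ∃[ N ] (∀ i → N ℕ.≤ i → seq x i ℚ.+ q ℚ.≤ seq y i))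

_≤ᵣ_ : ℝ → ℝ → Set
x ≤ᵣ y = ¬ (y <ᵣ x)

fromℚ : ℚ → ℝ
fromℚ p = mkℝ (λ _ → p)
  λ q 0<q → 0 , λ _ _ _ _ → subst (λ d → ∣ d ∣ ℚ.< q) (sym (ℚ.+-inverseʳ p)) 0<q

fromℤ : ℤ → ℝ
fromℤ z = fromℚ (z ℚ./ 1)

fromℕ : ℕ → ℝ
fromℕ m = fromℤ (+ m)

private
  Bounded : (ℕ → ℚ) → Set
  Bounded x = ∃[ B ] (ℚ.Positive B × ∃[ N ] (∀ i → N ℕ.≤ i → ∣ x i ∣ ℚ.≤ B))

  add-subtract : ∀ a b → a ≡ (a ℚ.- b) ℚ.+ b
  add-subtract = solve 2 (λ a b → a := (a :- b) :+ b) refl where open +-*-Solver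

  product-difference : ∀ a b c d →
    a ℚ.* b ℚ.- c ℚ.* d ≡ a ℚ.* (b ℚ.- d) ℚ.+ (a ℚ.- c) ℚ.* d
  product-difference =
    solve 4 (λ a b c d → a :* b :- c :* d := a :* (b :- d) :+ (a :- c) :* d) refl
    where open +-*-Solver

  near-bound : ∀ a b r → ∣ a ℚ.- b ∣ ℚ.≤ r → ∣ a ∣ ℚ.≤ r ℚ.+ ∣ b ∣
  near-bound a b r a-b≤r = begin
    ∣ a ∣                   ≡⟨ cong ∣_∣ (add-subtract a b) ⟩
    ∣ (a ℚ.- b) ℚ.+ b ∣     ≤⟨ ℚ.∣p+q∣≤∣p∣+∣q∣ (a ℚ.- b) b ⟩
    ∣ a ℚ.- b ∣ ℚ.+ ∣ b ∣   ≤⟨ ℚ.+-monoˡ-≤ ∣ b ∣ a-b≤r ⟩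
    r ℚ.+ ∣ b ∣             ∎
    where open ℚ.≤-Reasoning

  cauchy⇒bounded : ∀ x → Cauchy x → Bounded x
  cauchy⇒bounded x cx with cx 1ℚ (ℚ.positive⁻¹ 1ℚ)
  ... | N , close =
    1ℚ ℚ.+ ∣ x N ∣ ,
    ℚ.pos+nonNeg⇒pos 1ℚ ∣ x N ∣ {{ℚ.∣-∣-nonNeg (x N)}} ,
    N ,
    λ i N≤i → near-bound (x i) (x N) 1ℚ (ℚ.<⇒≤ (close i N N≤i ℕ.≤-refl))

  product-close : ∀ A B r → ℚ.Positive B → ℚ.Positive r → ∀ a b c d →
    ∣ a ∣ ℚ.≤ A → ∣ d ∣ ℚ.≤ B → ∣ a ℚ.- c ∣ ℚ.< r → ∣ b ℚ.- d ∣ ℚ.< r →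
    ∣ a ℚ.* b ℚ.- c ℚ.* d ∣ ℚ.< r ℚ.* (A ℚ.+ B)
  product-close A B r posB posr a b c d a≤A d≤B a-c<r b-d<r = begin-strict
    ∣ a ℚ.* b ℚ.- c ℚ.* d ∣
      ≡⟨ cong ∣_∣ (product-difference a b c d) ⟩
    ∣ a ℚ.* (b ℚ.- d) ℚ.+ (a ℚ.- c) ℚ.* d ∣
      ≤⟨ ℚ.∣p+q∣≤∣p∣+∣q∣ (a ℚ.* (b ℚ.- d)) ((a ℚ.- c) ℚ.* d) ⟩
    ∣ a ℚ.* (b ℚ.- d) ∣ ℚ.+ ∣ (a ℚ.- c) ℚ.* d ∣
      ≡⟨ cong₂ ℚ._+_ (ℚ.∣p*q∣≡∣p∣*∣q∣ a (b ℚ.- d)) (ℚ.∣p*q∣≡∣p∣*∣q∣ (a ℚ.- c) d) ⟩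
    ∣ a ∣ ℚ.* ∣ b ℚ.- d ∣ ℚ.+ ∣ a ℚ.- c ∣ ℚ.* ∣ d ∣
      ≤⟨ ℚ.+-mono-≤
           (ℚ.*-monoˡ-≤-nonNeg ∣ a ∣ {{ℚ.∣-∣-nonNeg a}} (ℚ.<⇒≤ b-d<r))
           (ℚ.*-monoˡ-≤-nonNeg ∣ a ℚ.- c ∣ {{ℚ.∣-∣-nonNeg (a ℚ.- c)}} d≤B) ⟩
    ∣ a ∣ ℚ.* r ℚ.+ ∣ a ℚ.- c ∣ ℚ.* B
      <⟨ ℚ.+-mono-≤-<
           (ℚ.*-monoʳ-≤-nonNeg r {{ℚ.pos⇒nonNeg r {{posr}}}} a≤A)
           (ℚ.*-monoˡ-<-pos B {{posB}} a-c<r) ⟩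
    A ℚ.* r ℚ.+ r ℚ.* B
      ≡⟨ cong (ℚ._+ r ℚ.* B) (ℚ.*-comm A r) ⟩
    r ℚ.* A ℚ.+ r ℚ.* B
      ≡⟨ sym (ℚ.*-distribˡ-+ r A B) ⟩
    r ℚ.* (A ℚ.+ B) ∎
    where open ℚ.≤-Reasoning

  divide : ∀ q B → ℚ.Positive q → ℚ.Positive B → ∃[ r ] (ℚ.Positive r × r ℚ.* B ≡ q)
  divide q B posq posB =
    q ℚ.* 1/B ,
    ℚ.pos*pos⇒pos q {{posq}} 1/B {{ℚ.1/pos⇒pos B {{posB}}}} ,
    trans (ℚ.*-assoc q 1/B B)
      (trans (cong (q ℚ.*_) (ℚ.*-inverseˡ B {{B≢0}})) (ℚ.*-identityʳ q))
    where
    B≢0 : ℚ.NonZero B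
    B≢0 = ℚ.pos⇒nonZero B {{posB}}
    1/B : ℚ
    1/B = ℚ.1/_ B {{B≢0}}

  *-cauchy : ∀ x y → Cauchy x → Cauchy y → Cauchy (λ i → x i ℚ.* y i)
  *-cauchy x y cx cy q 0<q =
    let A , posA , Na , boundA = cauchy⇒bounded x cx
        B , posB , Nb , boundB = cauchy⇒bounded y cy
        r , posr , r*[A+B]≡q =
          divide q (A ℚ.+ B) (ℚ.positive 0<q) (ℚ.pos+pos⇒pos A {{posA}} B {{posB}})
        0<r = ℚ.positive⁻¹ r {{posr}}
        Nx , closeX = cx r 0<r
        Ny , closeY = cy r 0<r
        a≤N = ℕ.≤-trans (ℕ.m≤m⊔n Na Nb) (ℕ.m≤m⊔n (Na ℕ.⊔ Nb) (Nx ℕ.⊔ Ny))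
        b≤N = ℕ.≤-trans (ℕ.m≤n⊔m Na Nb) (ℕ.m≤m⊔n (Na ℕ.⊔ Nb) (Nx ℕ.⊔ Ny))
        x≤N = ℕ.≤-trans (ℕ.m≤m⊔n Nx Ny) (ℕ.m≤n⊔m (Na ℕ.⊔ Nb) (Nx ℕ.⊔ Ny))
        y≤N = ℕ.≤-trans (ℕ.m≤n⊔m Nx Ny) (ℕ.m≤n⊔m (Na ℕ.⊔ Nb) (Nx ℕ.⊔ Ny))
    in (Na ℕ.⊔ Nb) ℕ.⊔ (Nx ℕ.⊔ Ny) ,
       λ i j N≤i N≤j →
         subst (∣ x i ℚ.* y i ℚ.- x j ℚ.* y j ∣ ℚ.<_) r*[A+B]≡q
           (product-close A B r posB posr (x i) (y i) (x j) (y j)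
             (boundA i (ℕ.≤-trans a≤N N≤i))
             (boundB j (ℕ.≤-trans b≤N N≤j))
             (closeX i j (ℕ.≤-trans x≤N N≤i) (ℕ.≤-trans x≤N N≤j))
             (closeY i j (ℕ.≤-trans y≤N N≤i) (ℕ.≤-trans y≤N N≤j)))

_*ᵣ_ : ℝ → ℝ → ℝ
x *ᵣ y = mkℝ (λ i → seq x i ℚ.* seq y i) (*-cauchy (seq x) (seq y) (cauchy x) (cauchy y))

-- The universe [n] is Fin n, and the stream is the whole list a (so m = length a);
-- freq a t counts occurrences among the first t items.
freq : ∀ {n} → List (Fin n) → ℕ → Fin n → ℤ
freq a t i = + length (filter (_≟ i) (take t a))

‖_‖² : ∀ {d} → (Fin d → ℤ) → ℤ
‖ v ‖² = sum (λ i → v i ℤ.* v i)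

-- The randomness behind Π: for each column, the row of its nonzero entry and
-- the sign of that entry.
Outcome : ℕ → ℕ → Set
Outcome k n = Vec (Fin k × Sign) n

countSketch : ∀ {k n} → Outcome k n → Fin k → Fin n → ℤ
countSketch ω j i =
  let row , sign = lookup ω i in
  if does (row ≟ j) then sign ◃ 1 else 0ℤ

infixl 7 _·_

_·_ : ∀ {k n} → (Fin k → Fin n → ℤ) → (Fin n → ℤ) → Fin k → ℤ
(Π · v) j = sum (λ i → Π j i ℤ.* v i)

vectors : ∀ {A : Set} → List A → ∀ n → List (Vec A n)
vectors xs zero    = [] ∷ []
vectors xs (suc n) = cartesianProductWith _∷_ xs (vectors xs n)

outcomes : ∀ k n → List (Outcome k n)
outcomes k n = vectors (cartesianProduct (allFin k) (Sign.+ ∷ Sign.- ∷ [])) n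

-- Independent columns, each with a uniform row and a uniform sign, make all
-- (k * 2) ^ n outcomes equally likely.
Pr : ∀ {k n} .{{_ : NonZero k}} {D : Pred (Outcome k n) 0ℓ} → Decidable D → ℚ
Pr {k} {n} D? =
  ℚ._/_ (+ length (filter D? (outcomes k n))) ((k ℕ.* 2) ℕ.^ n)
    {{ℕ.m^n≢0 (k ℕ.* 2) n {{ℕ.m*n≢0 k 2}}}}

-- An event comparing real numbers need not be decidable, so its outcomes cannot
-- be counted directly.  Its probability is bounded through its decidable
-- subevents; when the event itself is decidable (classically always) this is
-- equivalent to Pr E ≤ p.
Pr[_]≤_ : ∀ {k n} .{{_ : NonZero k}} → Pred (Outcome k n) 0ℓ → ℝ → Set₁
Pr[_]≤_ {k} {n} E p =
  ∀ {D : Pred (Outcome k n) 0ℓ} (D? : Decidable D) → D ⊆ E → fromℚ (Pr D?) ≤ᵣ p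

TrackingFails : ∀ {k n} → ℝ → List (Fin n) → Pred (Outcome k n) 0ℓ
TrackingFails ε a ω =
  ∃[ t ] (1 ℕ.≤ t × t ℕ.≤ length a ×
    ε *ᵣ fromℤ ‖ freq a (length a) ‖² <ᵣ
      fromℕ ℤ.∣ ‖ countSketch ω · freq a t ‖² ℤ.- ‖ freq a t ‖² ∣)

WeakTracking : ∀ {n} (k : ℕ) .{{_ : NonZero k}} → ℝ → ℝ → List (Fin n) → Set₁
WeakTracking {n} k ε δ a = Pr[ TrackingFails {k} {n} ε a ]≤ δ

{-# OPTIONS --safe #-}
module Submission where

-- Fix the rows h of the nonzero entries and let only the signs vary.  The error
-- X t = ‖Π f t‖² - ‖f t‖² is then a quadratic chaos with coefficients
-- 2 [h i = h j] f t i f t j.  These grow with t because the stream is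
-- insertion-only, so if μ t denotes the sum of their squares, an increment
-- X t - X s has squared norm at most μ t - μ s, hence by hypercontractivity a
-- fourth moment of order (μ t - μ s)².  This growth condition bounds the fourth
-- moment of the supremum over all times by a multiple of μ m², with no
-- logarithmic loss.  The probability over the signs of exceeding λ is therefore
-- at most min (1, C μ m² / λ⁴) ≤ √C μ m / λ², and averaging over h gives the
-- factor 1 / k, since a pair of columns collides with probability 1 / k.

open import Defs
open import Data.Bool using (true; false; if_then_else_)
open import Data.Fin as Fin using (Fin; zero; suc)
open import Data.Integer as ℤ
  using (ℤ; +_; -[1+_]; _+_; _*_; _-_; _^_; _≤_; _<_; 0ℤ; 1ℤ; -1ℤ; _◃_; +≤+; +<+; positive)
open import Data.Integer.Properties
open import Data.Integer.Tactic.RingSolver using (solve-∀)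
open import Data.List
  using (List; []; _∷_; _++_; allFin; cartesianProduct; cartesianProductWith; filter; length; map;
         tabulate; take)
open import Data.List.Membership.Propositional using (_∈_)
open import Data.List.Membership.Propositional.Properties
  using (∈-allFin; ∈-cartesianProduct⁺; ∈-cartesianProductWith⁺)
open import Data.List.Properties using (filter-accept; filter-none; length-tabulate)
import Data.List.Relation.Unary.All as All
open import Data.List.Relation.Unary.Any using (here; there)
open import Data.Nat as ℕ using (ℕ; zero; suc; NonZero)
import Data.Nat.Properties as ℕ
open import Data.Product using (_×_; _,_; ∃-syntax; proj₁; proj₂)
open import Data.Rational as ℚ using (ℚ; 0ℚ; 1ℚ; ↥_; ↧_; ↧ₙ_)
import Data.Rational.Properties as ℚ
open import Data.Rational.Solver using (module +-*-Solver)
import Data.Rational.Unnormalised as ℚᵘ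
import Data.Rational.Unnormalised.Properties as ℚᵘ
open import Data.Sign as Sign using (Sign)
open import Data.Sum using (_⊎_; inj₁; inj₂)
open import Data.Vec using (Vec; []; _∷_; lookup; zip)
open import Function using (_∘_; id)
open import Level using (0ℓ)
open import Relation.Binary.PropositionalEquality
open import Relation.Nullary using (¬_; Dec; yes; no; does; contradiction)
open import Relation.Unary using (Pred; Decidable; _⊆_)
open import Algebra.Properties.CommutativeMonoid.Sum +-0-commutativeMonoid
  using (sum; sum-cong-≗; sum-replicate-zero)

private
  variable
    A B C : Set

-- Squares, fourth powers and the order of the integers

infix 8 _² _⁴

_² _⁴ : ℤ → ℤ
x ² = x * x
x ⁴ = x ² ²

0≤x² : ∀ x → 0ℤ ≤ x ²
0≤x² (+ n)        = subst (0ℤ ≤_) (pos-* n n) (+≤+ ℕ.z≤n)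
0≤x² -[1+ n ] = +≤+ ℕ.z≤n

0≤+ : ∀ {x y} → 0ℤ ≤ x → 0ℤ ≤ y → 0ℤ ≤ x + y
0≤+ = +-mono-≤

0≤* : ∀ {x y} → 0ℤ ≤ x → 0ℤ ≤ y → 0ℤ ≤ x * y
0≤* {+ m} {+ n} _ _ = subst (0ℤ ≤_) (pos-* m n) (+≤+ ℕ.z≤n)

0≤+n : ∀ {n} → 0ℤ ≤ + n
0≤+n = +≤+ ℕ.z≤n

0≤[+n]^ : ∀ n k → 0ℤ ≤ (+ n) ^ k
0≤[+n]^ n zero    = 0≤+n
0≤[+n]^ n (suc k) = 0≤* {+ n} 0≤+n (0≤[+n]^ n k)

-- Most polynomial inequalities below go through this: a ring identity writes `y - x` as a `d` built
-- from squares and from differences already known to be nonnegative.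
≤-from-difference : ∀ {x y d} → y - x ≡ d → 0ℤ ≤ d → x ≤ y
≤-from-difference eq 0≤d = 0≤i-j⇒j≤i (subst (0ℤ ≤_) (sym eq) 0≤d)

*-mono-≤ : ∀ {a b c d} → 0ℤ ≤ a → 0ℤ ≤ d → a ≤ b → c ≤ d → a * c ≤ b * d
*-mono-≤ {a} {b} {c} {d} 0≤a 0≤d a≤b c≤d =
  ≤-from-difference (identity a b c d)
    (0≤+ (0≤* 0≤a (i≤j⇒0≤j-i c≤d)) (0≤* (i≤j⇒0≤j-i a≤b) 0≤d))
  where
  identity : ∀ a b c d → b * d - a * c ≡ a * (d - c) + (b - a) * d
  identity = solve-∀

*-monoˡ : ∀ {c a b} → 0ℤ ≤ c → a ≤ b → c * a ≤ c * b
*-monoˡ {+ c} _ a≤b = *-monoˡ-≤-nonNeg (+ c) a≤b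

-- Replaces square roots: a bound is proved for the squares and then pulled back.
x²≤y²⇒x≤y : ∀ {x y} → 0ℤ ≤ y → x ² ≤ y ² → x ≤ y
x²≤y²⇒x≤y {x} {y} 0≤y x²≤y² with x ≤? y
... | yes x≤y = x≤y
... | no x≰y  = contradiction (<-≤-trans y²<x² x²≤y²) (<-irrefl refl)
  where
  y<x : y < x
  y<x = ≰⇒> x≰y
  y²<x² : y ² < x ²
  y²<x² = ≤-<-trans (*-monoˡ 0≤y (<⇒≤ y<x))
            (*-monoʳ-<-pos x {{positive (≤-<-trans 0≤y y<x)}} y<x)

-- Sums over lists

∑ : List A → (A → ℤ) → ℤ
∑ []       f = 0ℤ
∑ (x ∷ xs) f = f x + ∑ xs f

∑-cong : ∀ (xs : List A) {f g : A → ℤ} → (∀ x → f x ≡ g x) → ∑ xs f ≡ ∑ xs g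
∑-cong []       f≡g = refl
∑-cong (x ∷ xs) f≡g = cong₂ _+_ (f≡g x) (∑-cong xs f≡g)

∑-mono-≤ : ∀ (xs : List A) {f g : A → ℤ} → (∀ x → f x ≤ g x) → ∑ xs f ≤ ∑ xs g
∑-mono-≤ []       f≤g = ≤-refl
∑-mono-≤ (x ∷ xs) f≤g = +-mono-≤ (f≤g x) (∑-mono-≤ xs f≤g)

∑-nonneg : ∀ (xs : List A) {f : A → ℤ} → (∀ x → 0ℤ ≤ f x) → 0ℤ ≤ ∑ xs f
∑-nonneg []       0≤f = ≤-refl
∑-nonneg (x ∷ xs) 0≤f = 0≤+ (0≤f x) (∑-nonneg xs 0≤f)

∑-distrib-+ : ∀ (xs : List A) (f g : A → ℤ) → ∑ xs (λ x → f x + g x) ≡ ∑ xs f + ∑ xs g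
∑-distrib-+ []       f g = refl
∑-distrib-+ (x ∷ xs) f g =
  trans (cong (_+_ (f x + g x)) (∑-distrib-+ xs f g)) (interchange (f x) (g x) (∑ xs f) (∑ xs g))
  where
  interchange : ∀ a b c d → a + b + (c + d) ≡ a + c + (b + d)
  interchange = solve-∀

*-distribˡ-∑ : ∀ c (xs : List A) (f : A → ℤ) → ∑ xs (λ x → c * f x) ≡ c * ∑ xs f
*-distribˡ-∑ c []       f = sym (*-zeroʳ c)
*-distribˡ-∑ c (x ∷ xs) f =
  trans (cong (_+_ (c * f x)) (*-distribˡ-∑ c xs f)) (sym (*-distribˡ-+ c (f x) (∑ xs f)))

∑-const : ∀ (xs : List A) c → ∑ xs (λ _ → c) ≡ + length xs * c
∑-const []       c = refl
∑-const (x ∷ xs) c = trans (cong (_+_ c) (∑-const xs c)) (sym (suc-* (+ length xs) c))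

∑-++ : ∀ (xs ys : List A) f → ∑ (xs ++ ys) f ≡ ∑ xs f + ∑ ys f
∑-++ []       ys f = sym (+-identityˡ (∑ ys f))
∑-++ (x ∷ xs) ys f =
  trans (cong (_+_ (f x)) (∑-++ xs ys f)) (sym (+-assoc (f x) (∑ xs f) (∑ ys f)))

∑-map : ∀ (g : A → B) xs f → ∑ (map g xs) f ≡ ∑ xs (λ x → f (g x))
∑-map g []       f = refl
∑-map g (x ∷ xs) f = cong (_+_ (f (g x))) (∑-map g xs f)

∑-cartesianProductWith : ∀ (g : A → B → C) xs ys f →
  ∑ (cartesianProductWith g xs ys) f ≡ ∑ xs (λ x → ∑ ys (λ y → f (g x y)))
∑-cartesianProductWith g []       ys f = refl
∑-cartesianProductWith g (x ∷ xs) ys f =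
  trans (∑-++ (map (g x) ys) (cartesianProductWith g xs ys) f)
    (cong₂ _+_ (∑-map (g x) ys f) (∑-cartesianProductWith g xs ys f))

∑-swap : ∀ (xs : List A) (ys : List B) (f : A → B → ℤ) →
  ∑ xs (λ x → ∑ ys (f x)) ≡ ∑ ys (λ y → ∑ xs (λ x → f x y))
∑-swap []       ys f = sym (trans (∑-const ys 0ℤ) (*-zeroʳ (+ length ys)))
∑-swap (x ∷ xs) ys f =
  trans (cong (_+_ (∑ ys (f x))) (∑-swap xs ys f))
    (sym (∑-distrib-+ ys (f x) (λ y → ∑ xs (λ x → f x y))))

-- Induction on the list. The new cross term 2Sab is at most Fb² + Ga² because the squares of the
-- two differ by (Fb² - Ga²)² + 4a²b²(FG - S²).
cauchy-schwarz : ∀ (xs : List A) (f g : A → ℤ) →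
  ∑ xs (λ x → f x * g x) ² ≤ ∑ xs (λ x → f x ²) * ∑ xs (λ x → g x ²)
cauchy-schwarz []       f g = ≤-refl
cauchy-schwarz (x ∷ xs) f g =
  ≤-from-difference (expand (f x) (g x) F G S)
    (0≤+ (i≤j⇒0≤j-i S²≤FG) (i≤j⇒0≤j-i cross))
  where
  F = ∑ xs (λ x → f x ²)
  G = ∑ xs (λ x → g x ²)
  S = ∑ xs (λ x → f x * g x)
  S²≤FG : S ² ≤ F * G
  S²≤FG = cauchy-schwarz xs f g
  expand : ∀ a b F G S → (a * a + F) * (b * b + G) - (a * b + S) * (a * b + S) ≡
    (F * G - S * S) + (F * (b * b) + G * (a * a) - + 2 * (S * (a * b)))
  expand = solve-∀
  square-gap : ∀ a b F G S →
    (F * (b * b) + G * (a * a)) * (F * (b * b) + G * (a * a)) -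
      (+ 2 * (S * (a * b))) * (+ 2 * (S * (a * b))) ≡
    (F * (b * b) - G * (a * a)) * (F * (b * b) - G * (a * a)) +
      (+ 4 * ((a * b) * (a * b))) * (F * G - S * S)
  square-gap = solve-∀
  cross : + 2 * (S * (f x * g x)) ≤ F * g x ² + G * f x ²
  cross = x²≤y²⇒x≤y
    (0≤+ (0≤* (∑-nonneg xs (λ y → 0≤x² (f y))) (0≤x² (g x)))
         (0≤* (∑-nonneg xs (λ y → 0≤x² (g y))) (0≤x² (f x))))
    (≤-from-difference (square-gap (f x) (g x) F G S)
      (0≤+ (0≤x² (F * g x ² - G * f x ²))
           (0≤* (0≤* {+ 4} 0≤+n (0≤x² (f x * g x))) (i≤j⇒0≤j-i S²≤FG))))

-- Hypercontractivity on the cube of signs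

-- A multilinear polynomial of degree at most d in n signs is either constant or
-- p + s q with s the first sign and p, q free of it.
data Chaos : ℕ → ℕ → Set where
  const : ∀ {d n} → ℤ → Chaos d n
  _⊕_   : ∀ {d n} → Chaos (suc d) n → Chaos d n → Chaos (suc d) (suc n)

eval : ∀ {d n} → Chaos d n → Vec Sign n → ℤ
eval (const c) σ       = c
eval (p ⊕ q)   (s ∷ σ) = eval p σ + (s ◃ 1) * eval q σ

-- The sum of the squared coefficients. Distinct monomials in independent signs are orthonormal, so
-- this is also the second moment of the polynomial under uniform signs.
norm² : ∀ {d n} → Chaos d n → ℤ
norm² (const c) = c ²
norm² (p ⊕ q)   = norm² p + norm² q

norm²-nonneg : ∀ {d n} (p : Chaos d n) → 0ℤ ≤ norm² p
norm²-nonneg (const c) = 0≤x² c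
norm²-nonneg (p ⊕ q)   = 0≤+ (norm²-nonneg p) (norm²-nonneg q)

signs : List Sign
signs = Sign.+ ∷ Sign.- ∷ []

length-vectors : ∀ (xs : List A) n → + length (vectors xs n) ≡ (+ length xs) ^ n
length-vectors xs n =
  trans (sym (trans (∑-const (vectors xs n) 1ℤ) (*-identityʳ _))) (count n)
  where
  count : ∀ n → ∑ (vectors xs n) (λ _ → 1ℤ) ≡ (+ length xs) ^ n
  count zero    = refl
  count (suc n) = trans (∑-cartesianProductWith _∷_ xs (vectors xs n) (λ _ → 1ℤ))
    (trans (∑-const xs (∑ (vectors xs n) (λ _ → 1ℤ))) (cong (_*_ (+ length xs)) (count n)))

-- Bonami's lemma E X⁴ ≤ 9^d (E X²)², with expectations replaced by sums over the 2^n sign vectors.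
-- Averaging (a + sb)⁴ over the first sign s kills the odd powers and leaves a⁴ + 6a²b² + b⁴; the
-- mixed term is handled by Cauchy-Schwarz.
hypercontractivity : ∀ {d n} (p : Chaos d n) →
  ∑ (vectors signs n) (λ σ → eval p σ ⁴) ≤ (+ 9) ^ d * (+ 2) ^ n * norm² p ²
hypercontractivity {d} {n} (const c) =
  ≤-trans (≤-reflexive (trans (∑-const (vectors signs n) (c ⁴)) (cong (_* c ⁴) (length-vectors signs n))))
    (subst (_≤ (+ 9) ^ d * (+ 2) ^ n * c ⁴) (cong (_* c ⁴) (*-identityˡ ((+ 2) ^ n)))
      (*-mono-≤ (0≤* {1ℤ} 0≤+n (0≤[+n]^ 2 n)) (0≤x² (c ²))
        (*-mono-≤ {1ℤ} 0≤+n (0≤[+n]^ 2 n) (1≤9^ d) ≤-refl) ≤-refl))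
  where
  1≤9^ : ∀ d → 1ℤ ≤ (+ 9) ^ d
  1≤9^ zero    = ≤-refl
  1≤9^ (suc d) = *-mono-≤ {1ℤ} {+ 9} {1ℤ} 0≤+n (0≤[+n]^ 9 d) (+≤+ (ℕ.s≤s ℕ.z≤n)) (1≤9^ d)
hypercontractivity {suc d} {suc n} (p ⊕ q) = begin
  ∑ (vectors signs (suc n)) (λ σ → eval (p ⊕ q) σ ⁴)
    ≡⟨ ∑-cartesianProductWith _∷_ signs Σσ (λ σ → eval (p ⊕ q) σ ⁴) ⟩
  ∑ Σσ (λ σ → (a σ + 1ℤ * b σ) ⁴) + (∑ Σσ (λ σ → (a σ + -1ℤ * b σ) ⁴) + 0ℤ)
    ≡⟨ cong (_+_ (∑ Σσ (λ σ → (a σ + 1ℤ * b σ) ⁴))) (+-identityʳ _) ⟩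
  ∑ Σσ (λ σ → (a σ + 1ℤ * b σ) ⁴) + ∑ Σσ (λ σ → (a σ + -1ℤ * b σ) ⁴)
    ≡⟨ ∑-distrib-+ Σσ (λ σ → (a σ + 1ℤ * b σ) ⁴) (λ σ → (a σ + -1ℤ * b σ) ⁴) ⟨
  ∑ Σσ (λ σ → (a σ + 1ℤ * b σ) ⁴ + (a σ + -1ℤ * b σ) ⁴)
    ≡⟨ ∑-cong Σσ (λ σ → average (a σ) (b σ)) ⟩
  ∑ Σσ (λ σ → + 2 * a σ ⁴ + (+ 12 * (a σ ² * b σ ²) + + 2 * b σ ⁴))
    ≡⟨ ∑-distrib-+ Σσ (λ σ → + 2 * a σ ⁴) (λ σ → + 12 * (a σ ² * b σ ²) + + 2 * b σ ⁴) ⟩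
  ∑ Σσ (λ σ → + 2 * a σ ⁴) + ∑ Σσ (λ σ → + 12 * (a σ ² * b σ ²) + + 2 * b σ ⁴)
    ≡⟨ cong₂ _+_ (*-distribˡ-∑ (+ 2) Σσ (λ σ → a σ ⁴))
         (trans (∑-distrib-+ Σσ (λ σ → + 12 * (a σ ² * b σ ²)) (λ σ → + 2 * b σ ⁴))
           (cong₂ _+_ (*-distribˡ-∑ (+ 12) Σσ (λ σ → a σ ² * b σ ²))
             (*-distribˡ-∑ (+ 2) Σσ (λ σ → b σ ⁴)))) ⟩
  + 2 * P + (+ 12 * R + + 2 * S)
    -- With A = `norm² p` and B = `norm² q`, the three bounds add up to D(18A² + 36AB + 2B²), and
    -- 18D(A + B)² exceeds this by 16DB².
    ≤⟨ ≤-from-difference (gap P R S ((+ 9) ^ d) ((+ 2) ^ n) (norm² p) (norm² q))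
         (0≤+ (0≤+ (0≤+ (0≤* {+ 2} 0≤+n (i≤j⇒0≤j-i P≤))
                        (0≤* {+ 12} 0≤+n (i≤j⇒0≤j-i R≤)))
                   (0≤* {+ 2} 0≤+n (i≤j⇒0≤j-i S≤)))
              (0≤* {+ 16} 0≤+n 0≤DB²)) ⟩
  (+ 9) ^ suc d * (+ 2) ^ suc n * (norm² p + norm² q) ² ∎
  where
  open ≤-Reasoning
  Σσ = vectors signs n
  a b : Vec Sign n → ℤ
  a = eval p
  b = eval q
  P = ∑ Σσ (λ σ → a σ ⁴)
  R = ∑ Σσ (λ σ → a σ ² * b σ ²)
  S = ∑ Σσ (λ σ → b σ ⁴)
  D = (+ 9) ^ d * (+ 2) ^ n
  0≤D : 0ℤ ≤ D
  0≤D = 0≤* (0≤[+n]^ 9 d) (0≤[+n]^ 2 n)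
  0≤DB² : 0ℤ ≤ D * norm² q ²
  0≤DB² = 0≤* 0≤D (0≤x² (norm² q))
  P≤ : P ≤ (+ 9 * (+ 9) ^ d) * (+ 2) ^ n * norm² p ²
  P≤ = hypercontractivity p
  S≤ : S ≤ D * norm² q ²
  S≤ = hypercontractivity q
  average : ∀ x y →
    ((x + 1ℤ * y) * (x + 1ℤ * y)) * ((x + 1ℤ * y) * (x + 1ℤ * y)) +
    ((x + -1ℤ * y) * (x + -1ℤ * y)) * ((x + -1ℤ * y) * (x + -1ℤ * y)) ≡
    + 2 * ((x * x) * (x * x)) + (+ 12 * ((x * x) * (y * y)) + + 2 * ((y * y) * (y * y)))
  average = solve-∀
  gap : ∀ P R S N T A B →
    (+ 9 * N) * (+ 2 * T) * ((A + B) * (A + B)) - (+ 2 * P + (+ 12 * R + + 2 * S)) ≡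
    + 2 * ((+ 9 * N) * T * (A * A) - P) + + 12 * (+ 3 * (N * T * (A * B)) - R) +
      + 2 * (N * T * (B * B) - S) + + 16 * (N * T * (B * B))
  gap = solve-∀
  regroup : ∀ N T A B → ((+ 9 * N) * T * (A * A)) * (N * T * (B * B)) ≡
    (+ 3 * (N * T * (A * B))) * (+ 3 * (N * T * (A * B)))
  regroup = solve-∀
  -- Since `q` has degree one less than `p`, the geometric mean of 9DA² and DB² costs only a factor
  -- 3.
  R≤ : R ≤ + 3 * (D * (norm² p * norm² q))
  R≤ = x²≤y²⇒x≤y
    (0≤* {+ 3} 0≤+n (0≤* 0≤D (0≤* (norm²-nonneg p) (norm²-nonneg q))))
    (≤-trans (cauchy-schwarz Σσ (λ σ → a σ ²) (λ σ → b σ ²))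
      (≤-trans (*-mono-≤ (∑-nonneg Σσ (λ σ → 0≤x² (a σ ²))) 0≤DB² P≤ S≤)
        (≤-reflexive (regroup ((+ 9) ^ d) ((+ 2) ^ n) (norm² p) (norm² q)))))

-- A maximal inequality

-- A discrete intermediate value argument: walk down from `t` until `dichotomy` answers `P`; at `s`
-- the walk stops in any case.
crossing : ∀ {P Q : ℕ → Set} → (∀ v → P v ⊎ Q v) → ∀ {s} t → s ℕ.< t → P s → Q t →
  ∃[ v ] (s ℕ.≤ v × v ℕ.< t × P v × Q (suc v))
crossing dichotomy {s} (suc t) s<1+t Ps Qt with dichotomy t
... | inj₁ Pt = t , ℕ.≤-pred s<1+t , ℕ.n<1+n t , Pt , Qt
... | inj₂ Qt′ with ℕ.m<1+n⇒m<n∨m≡n s<1+t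
...   | inj₂ refl = s , ℕ.≤-refl , ℕ.n<1+n s , Ps , Qt
...   | inj₁ s<t with crossing dichotomy t s<t Ps Qt′
...     | v , s≤v , v<t , Pv , Qv = v , s≤v , ℕ.m<n⇒m<1+n v<t , Pv , Qv

-- A Kolmogorov-type moment condition: fourth moments of increments are quadratic in the increase of
-- `μ`. The exponent 2 exceeds 1, so under bisection the bounds shrink faster than the number of
-- intervals grows, and no logarithmic factor arises.
module _ (xs : List A) (X : ℕ → A → ℤ) (μ : ℕ → ℤ) (c : ℤ) (0≤c : 0ℤ ≤ c)
  (μ-mono : ∀ {s t} → s ℕ.≤ t → μ s ≤ μ t)
  (increments : ∀ {s t} → s ℕ.≤ t →
    ∑ xs (λ ω → (X t ω - X s ω) ⁴) ≤ c * (μ t - μ s) ²)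
  where

  -- `μ` may jump, so no index need sit exactly half way. The step from `v` to `suc v` straddles the
  -- middle value and belongs to neither half.
  midpoint : ∀ {s t} → s ℕ.< t →
    ∃[ v ] (s ℕ.≤ v × v ℕ.< t ×
      + 2 * (μ v - μ s) ≤ μ t - μ s × + 2 * (μ t - μ (suc v)) ≤ μ t - μ s)
  midpoint {s} {t} s<t =
    let v , s≤v , v<t , low , high = crossing dichotomy t s<t low-s high-t
    in v , s≤v , v<t , low , ≤-from-difference (flip-half (μ (suc v)) (μ s) (μ t)) (i≤j⇒0≤j-i high)
    where
    g = μ t - μ s
    0≤g : 0ℤ ≤ g
    0≤g = i≤j⇒0≤j-i (μ-mono (ℕ.<⇒≤ s<t))
    dichotomy : ∀ v → + 2 * (μ v - μ s) ≤ g ⊎ g ≤ + 2 * (μ v - μ s)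
    dichotomy v = ≤-total (+ 2 * (μ v - μ s)) g
    low-s : + 2 * (μ s - μ s) ≤ g
    low-s = ≤-trans (≤-reflexive (cong (_*_ (+ 2)) (+-inverseʳ (μ s)))) 0≤g
    double-gap : ∀ x → + 2 * x - x ≡ x
    double-gap = solve-∀
    high-t : g ≤ + 2 * g
    high-t = ≤-from-difference (double-gap g) 0≤g
    flip-half : ∀ u s t → (t - s) - + 2 * (t - u) ≡ + 2 * (u - s) - (t - s)
    flip-half = solve-∀

  -- The inductive step of `maximal` for a given splitting index; the two recurse mutually while `l`
  -- decreases.
  halve : ∀ l {s t} → s ℕ.≤ t → t ℕ.≤ suc l ℕ.+ s →
    ∀ τ → (∀ ω → s ℕ.≤ τ ω) → (∀ ω → τ ω ℕ.≤ t) →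
    ∀ v → s ℕ.≤ v → v ℕ.< t →
    + 2 * (μ v - μ s) ≤ μ t - μ s → + 2 * (μ t - μ (suc v)) ≤ μ t - μ s →
    ∑ xs (λ ω → (X (τ ω) ω - X s ω) ⁴) ≤ + 500 * c * (μ t - μ s) ²

  -- The supremum over the times in [s, t] is expressed through an arbitrary
  -- time-valued function τ.  Splitting [s, t] where μ has gone half way leaves
  -- two intervals that contribute at most (1/4 + 2/4) of the claimed bound.
  maximal : ∀ l {s t} → s ℕ.≤ t → t ℕ.≤ l ℕ.+ s →
    ∀ τ → (∀ ω → s ℕ.≤ τ ω) → (∀ ω → τ ω ℕ.≤ t) →
    ∑ xs (λ ω → (X (τ ω) ω - X s ω) ⁴) ≤ + 500 * c * (μ t - μ s) ²
  -- `l` bounds the length of the interval; for `zero` the only admissible time is `s`.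
  maximal zero {s} {t} s≤t t≤s τ s≤τ τ≤t = begin
    ∑ xs (λ ω → (X (τ ω) ω - X s ω) ⁴) ≡⟨ ∑-cong xs still ⟩
    ∑ xs (λ _ → 0ℤ)                    ≡⟨ ∑-const xs 0ℤ ⟩
    + length xs * 0ℤ                   ≡⟨ *-zeroʳ (+ length xs) ⟩
    0ℤ                                 ≤⟨ 0≤* (0≤* {+ 500} 0≤+n 0≤c) (0≤x² (μ t - μ s)) ⟩
    + 500 * c * (μ t - μ s) ²          ∎
    where
    open ≤-Reasoning
    still : ∀ ω → (X (τ ω) ω - X s ω) ⁴ ≡ 0ℤ
    still ω = cong _⁴ (trans
      (cong (λ u → X u ω - X s ω) (ℕ.≤-antisym (ℕ.≤-trans (τ≤t ω) t≤s) (s≤τ ω)))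
      (+-inverseʳ (X s ω)))
  maximal (suc l) {s} {t} s≤t t≤1+l+s τ s≤τ τ≤t = case (ℕ.m≤n⇒m<n∨m≡n s≤t)
    where
    case : s ℕ.< t ⊎ s ≡ t → ∑ xs (λ ω → (X (τ ω) ω - X s ω) ⁴) ≤ + 500 * c * (μ t - μ s) ²
    case (inj₂ s≡t) = maximal l s≤t (ℕ.≤-trans (ℕ.≤-reflexive (sym s≡t)) (ℕ.m≤n+m s l)) τ s≤τ τ≤t
    case (inj₁ s<t) =
      let v , s≤v , v<t , low , high = midpoint s<t
      in halve l s≤t t≤1+l+s τ s≤τ τ≤t v s≤v v<t low high

  halve l {s} {t} s≤t t≤1+l+s τ s≤τ τ≤t v s≤v v<t low high = begin
    ∑ xs (λ ω → (X (τ ω) ω - X s ω) ⁴)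
      ≤⟨ ∑-mono-≤ xs split ⟩
    ∑ xs (λ ω → a ω + (+ 2 * b ω + + 125 * e ω))
      ≡⟨ ∑-distrib-+ xs a (λ ω → + 2 * b ω + + 125 * e ω) ⟩
    ∑ xs a + ∑ xs (λ ω → + 2 * b ω + + 125 * e ω)
      ≡⟨ cong (_+_ (∑ xs a)) (trans (∑-distrib-+ xs (λ ω → + 2 * b ω) (λ ω → + 125 * e ω))
           (cong₂ _+_ (*-distribˡ-∑ (+ 2) xs b) (*-distribˡ-∑ (+ 125) xs e))) ⟩
    ∑ xs a + (+ 2 * ∑ xs b + + 125 * ∑ xs e)
      -- The left half costs 500/4 = 125, the right half 2 · 500/4 = 250 and the passage from `s` to
      -- `suc v` 125, which uses up the 500 exactly.
      ≤⟨ ≤-from-difference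
           (budget c (∑ xs a) (∑ xs b) (∑ xs e) (μ v - μ s) (μ t - μ (suc v)) (μ u - μ s) (μ t - μ s))
           (0≤+ (0≤+ (0≤+ (i≤j⇒0≤j-i left) (0≤* {+ 2} 0≤+n (i≤j⇒0≤j-i right)))
                     (0≤* {+ 125} 0≤+n (i≤j⇒0≤j-i middle)))
                (0≤* 0≤c (0≤+ (0≤+
                  (0≤* {+ 125} 0≤+n (i≤j⇒0≤j-i (half² (i≤j⇒0≤j-i (μ-mono s≤v)) low)))
                  (0≤* {+ 250} 0≤+n (i≤j⇒0≤j-i (half² (i≤j⇒0≤j-i (μ-mono v<t)) high))))
                  (0≤* {+ 125} 0≤+n (i≤j⇒0≤j-i (*-mono-≤ 0≤u-s 0≤t-s u-s≤t-s u-s≤t-s)))))) ⟩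
    + 500 * c * (μ t - μ s) ² ∎
    where
    open ≤-Reasoning
    u = suc v
    -- Clipping `τ` at `v` from above, or at `u` from below, gives admissible times in each half for
    -- every ω, wherever `τ ω` lies.
    a b e : A → ℤ
    a ω = (X (τ ω ℕ.⊓ v) ω - X s ω) ⁴
    b ω = (X (τ ω ℕ.⊔ u) ω - X u ω) ⁴
    e ω = (X u ω - X s ω) ⁴
    left : ∑ xs a ≤ + 500 * c * (μ v - μ s) ²
    left = maximal l s≤v (ℕ.≤-pred (ℕ.≤-trans v<t t≤1+l+s)) (λ ω → τ ω ℕ.⊓ v)
      (λ ω → ℕ.⊓-glb (s≤τ ω) s≤v) (λ ω → ℕ.m⊓n≤n (τ ω) v)
    t≤l+u : t ℕ.≤ l ℕ.+ u
    t≤l+u = ℕ.≤-trans t≤1+l+s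
      (ℕ.≤-trans (ℕ.s≤s (ℕ.+-monoʳ-≤ l s≤v)) (ℕ.≤-reflexive (sym (ℕ.+-suc l v))))
    right : ∑ xs b ≤ + 500 * c * (μ t - μ u) ²
    right = maximal l v<t t≤l+u (λ ω → τ ω ℕ.⊔ u)
      (λ ω → ℕ.m≤n⊔m (τ ω) u) (λ ω → ℕ.⊔-lub (τ≤t ω) v<t)
    middle : ∑ xs e ≤ c * (μ u - μ s) ²
    middle = increments (ℕ.m≤n⇒m≤1+n s≤v)
    0≤u-s : 0ℤ ≤ μ u - μ s
    0≤u-s = i≤j⇒0≤j-i (μ-mono (ℕ.m≤n⇒m≤1+n s≤v))
    0≤t-s : 0ℤ ≤ μ t - μ s
    0≤t-s = i≤j⇒0≤j-i (μ-mono s≤t)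
    u-s≤t-s : μ u - μ s ≤ μ t - μ s
    u-s≤t-s = +-monoˡ-≤ _ (μ-mono v<t)
    quadruple : ∀ x → (+ 2 * x) * (+ 2 * x) ≡ + 4 * (x * x)
    quadruple = solve-∀
    half² : ∀ {x} → 0ℤ ≤ x → + 2 * x ≤ μ t - μ s → + 4 * x ² ≤ (μ t - μ s) ²
    half² {x} 0≤x 2x≤g = ≤-trans (≤-reflexive (sym (quadruple x)))
      (*-mono-≤ (0≤* {+ 2} 0≤+n 0≤x) 0≤t-s 2x≤g 2x≤g)
    budget : ∀ c α β ε x y z g →
      + 500 * c * (g * g) - (α + (+ 2 * β + + 125 * ε)) ≡
      (+ 500 * c * (x * x) - α) + + 2 * (+ 500 * c * (y * y) - β) + + 125 * (c * (z * z) - ε) +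
      c * (+ 125 * (g * g - + 4 * (x * x)) + + 250 * (g * g - + 4 * (y * y)) +
           + 125 * (g * g - z * z))
    budget = solve-∀
    -- A coefficient of x⁴ below 3 is what lets the induction close.
    fourth-power : ∀ x y → (x + y) ⁴ ≤ + 2 * x ⁴ + + 125 * y ⁴
    fourth-power x y = ≤-from-difference (identity x y)
      (0≤+ (0≤x² (x * x - + 2 * (x * y) - + 7 * (y * y)))
        (0≤+ (0≤x² (y * (+ 2 * x - + 8 * y))) (0≤* {+ 11} 0≤+n (0≤x² (y ²)))))
      where
      identity : ∀ x y →
        + 2 * ((x * x) * (x * x)) + + 125 * ((y * y) * (y * y)) -
          ((x + y) * (x + y)) * ((x + y) * (x + y)) ≡
        (x * x - + 2 * (x * y) - + 7 * (y * y)) * (x * x - + 2 * (x * y) - + 7 * (y * y)) +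
          ((y * (+ 2 * x - + 8 * y)) * (y * (+ 2 * x - + 8 * y)) + + 11 * ((y * y) * (y * y)))
      identity = solve-∀
    telescope : ∀ x y z → x - z ≡ (x - y) + (y - z)
    telescope = solve-∀
    -- For each ω only the half containing `τ ω` matters. A path ending beyond `v` is cut at `u`,
    -- and `fourth-power` pays for the two pieces.
    split : ∀ ω → (X (τ ω) ω - X s ω) ⁴ ≤ a ω + (+ 2 * b ω + + 125 * e ω)
    split ω = case (ℕ.≤-<-connex (τ ω) v)
      where
      case : τ ω ℕ.≤ v ⊎ v ℕ.< τ ω →
        (X (τ ω) ω - X s ω) ⁴ ≤ a ω + (+ 2 * b ω + + 125 * e ω)
      case (inj₁ τ≤v) = begin
        (X (τ ω) ω - X s ω) ⁴
          ≡⟨ cong (λ r → (X r ω - X s ω) ⁴) (ℕ.m≤n⇒m⊓n≡m τ≤v) ⟨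
        a ω
          ≡⟨ +-identityʳ (a ω) ⟨
        a ω + 0ℤ
          ≤⟨ +-monoʳ-≤ (a ω) (0≤+
               (0≤* {+ 2} 0≤+n (0≤x² ((X (τ ω ℕ.⊔ u) ω - X u ω) ²)))
               (0≤* {+ 125} 0≤+n (0≤x² ((X u ω - X s ω) ²)))) ⟩
        a ω + (+ 2 * b ω + + 125 * e ω) ∎
      case (inj₂ v<τ) = begin
        (X (τ ω) ω - X s ω) ⁴
          ≡⟨ cong _⁴ (telescope (X (τ ω) ω) (X u ω) (X s ω)) ⟩
        (X (τ ω) ω - X u ω + (X u ω - X s ω)) ⁴
          ≡⟨ cong (λ r → (X r ω - X u ω + (X u ω - X s ω)) ⁴) (ℕ.m≥n⇒m⊔n≡m v<τ) ⟨
        (X (τ ω ℕ.⊔ u) ω - X u ω + (X u ω - X s ω)) ⁴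
          ≤⟨ fourth-power (X (τ ω ℕ.⊔ u) ω - X u ω) (X u ω - X s ω) ⟩
        + 2 * b ω + + 125 * e ω
          ≡⟨ +-identityˡ (+ 2 * b ω + + 125 * e ω) ⟨
        0ℤ + (+ 2 * b ω + + 125 * e ω)
          ≤⟨ +-monoˡ-≤ (+ 2 * b ω + + 125 * e ω) (0≤x² ((X (τ ω ℕ.⊓ v) ω - X s ω) ²)) ⟩
        a ω + (+ 2 * b ω + + 125 * e ω) ∎

-- The sketching error as a quadratic form in the signs

linear : ∀ {n} → (Fin n → ℤ) → Chaos 1 n
linear {zero}  ℓ = const 0ℤ
linear {suc n} ℓ = linear (ℓ ∘ suc) ⊕ const (ℓ zero)

-- Only the coefficients g i j with i > j are used.
quadratic : ∀ {n} → (Fin n → Fin n → ℤ) → Chaos 2 n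
quadratic {zero}  g = const 0ℤ
quadratic {suc n} g = quadratic (λ i j → g (suc i) (suc j)) ⊕ linear (λ i → g (suc i) zero)

eval-linear-- : ∀ {n} (ℓ ℓ′ : Fin n → ℤ) σ →
  eval (linear (λ i → ℓ i - ℓ′ i)) σ ≡ eval (linear ℓ) σ - eval (linear ℓ′) σ
eval-linear-- ℓ ℓ′ []      = refl
eval-linear-- ℓ ℓ′ (s ∷ σ) =
  trans (cong (_+ (s ◃ 1) * (ℓ zero - ℓ′ zero)) (eval-linear-- (ℓ ∘ suc) (ℓ′ ∘ suc) σ))
    (regroup (eval (linear (ℓ ∘ suc)) σ) (eval (linear (ℓ′ ∘ suc)) σ) (s ◃ 1) (ℓ zero) (ℓ′ zero))
  where
  regroup : ∀ a b s x y → a - b + s * (x - y) ≡ a + s * x - (b + s * y)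
  regroup = solve-∀

eval-quadratic-- : ∀ {n} (g g′ : Fin n → Fin n → ℤ) σ →
  eval (quadratic (λ i j → g i j - g′ i j)) σ ≡ eval (quadratic g) σ - eval (quadratic g′) σ
eval-quadratic-- g g′ []      = refl
eval-quadratic-- g g′ (s ∷ σ) =
  trans (cong₂ (λ a b → a + (s ◃ 1) * b) (eval-quadratic-- gₛ gₛ′ σ) (eval-linear-- g₀ g₀′ σ))
    (regroup (eval (quadratic gₛ) σ) (eval (quadratic gₛ′) σ) (s ◃ 1)
      (eval (linear g₀) σ) (eval (linear g₀′) σ))
  where
  gₛ  = λ i j → g (suc i) (suc j)
  gₛ′ = λ i j → g′ (suc i) (suc j)
  g₀  = λ i → g (suc i) zero
  g₀′ = λ i → g′ (suc i) zero
  regroup : ∀ a b s x y → a - b + s * (x - y) ≡ a + s * x - (b + s * y)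
  regroup = solve-∀

-- The gap is 2y(x - y). Applied to nonnegative coefficients that only grow, it bounds the squared
-- norm of an increment by the increase of the squared norm.
[x-y]²≤x²-y² : ∀ {x y} → 0ℤ ≤ y → y ≤ x → (x - y) ² ≤ x ² - y ²
[x-y]²≤x²-y² {x} {y} 0≤y y≤x = ≤-from-difference (identity x y)
  (0≤* {+ 2} 0≤+n (0≤* 0≤y (i≤j⇒0≤j-i y≤x)))
  where
  identity : ∀ x y → (x * x - y * y) - (x - y) * (x - y) ≡ + 2 * (y * (x - y))
  identity = solve-∀

difference-of-sums : ∀ a a′ b b′ → (a - a′) + (b - b′) ≡ (a + b) - (a′ + b′)
difference-of-sums = solve-∀

norm²-linear-- : ∀ {n} (ℓ ℓ′ : Fin n → ℤ) → (∀ i → 0ℤ ≤ ℓ′ i) → (∀ i → ℓ′ i ≤ ℓ i) →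
  norm² (linear (λ i → ℓ i - ℓ′ i)) ≤ norm² (linear ℓ) - norm² (linear ℓ′)
norm²-linear-- {zero}  ℓ ℓ′ 0≤ℓ′ ℓ′≤ℓ = ≤-refl
norm²-linear-- {suc n} ℓ ℓ′ 0≤ℓ′ ℓ′≤ℓ = ≤-trans
  (+-mono-≤ (norm²-linear-- (ℓ ∘ suc) (ℓ′ ∘ suc) (0≤ℓ′ ∘ suc) (ℓ′≤ℓ ∘ suc))
            ([x-y]²≤x²-y² (0≤ℓ′ zero) (ℓ′≤ℓ zero)))
  (≤-reflexive (difference-of-sums (norm² (linear (ℓ ∘ suc))) (norm² (linear (ℓ′ ∘ suc))) _ _))

norm²-quadratic-- : ∀ {n} (g g′ : Fin n → Fin n → ℤ) →
  (∀ i j → 0ℤ ≤ g′ i j) → (∀ i j → g′ i j ≤ g i j) →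
  norm² (quadratic (λ i j → g i j - g′ i j)) ≤ norm² (quadratic g) - norm² (quadratic g′)
norm²-quadratic-- {zero}  g g′ 0≤g′ g′≤g = ≤-refl
norm²-quadratic-- {suc n} g g′ 0≤g′ g′≤g = ≤-trans
  (+-mono-≤
    (norm²-quadratic-- (λ i j → g (suc i) (suc j)) (λ i j → g′ (suc i) (suc j))
      (λ i j → 0≤g′ (suc i) (suc j)) (λ i j → g′≤g (suc i) (suc j)))
    (norm²-linear-- (λ i → g (suc i) zero) (λ i → g′ (suc i) zero)
      (λ i → 0≤g′ (suc i) zero) (λ i → g′≤g (suc i) zero)))
  (≤-reflexive (difference-of-sums
    (norm² (quadratic (λ i j → g (suc i) (suc j))))
    (norm² (quadratic (λ i j → g′ (suc i) (suc j)))) _ _))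

collides : ∀ {k} → Fin k → Fin k → ℤ
collides r s = if does (r Fin.≟ s) then 1ℤ else 0ℤ

-- Two columns interact in ‖Πv‖² only if they share a row. The factor 2 covers both orders of a
-- pair, as `quadratic` reads just one of them.
collisions : ∀ {k n} → Vec (Fin k) n → (Fin n → ℤ) → Fin n → Fin n → ℤ
collisions h v i j = + 2 * (collides (lookup h i) (lookup h j) * (v i * v j))

error : ∀ {k n} → Outcome k n → (Fin n → ℤ) → ℤ
error ω v = ‖ countSketch ω · v ‖² - ‖ v ‖²

if≡if1* : ∀ b c → (if b then c else 0ℤ) ≡ (if b then 1ℤ else 0ℤ) * c
if≡if1* true  c = sym (*-identityˡ c)
if≡if1* false c = refl

-- The cross term that appears when a new column of weight `x` lands in row `r` and the square of
-- that row is expanded.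
eval-linear-row : ∀ {k n} (h : Vec (Fin k) n) σ v r x →
  eval (linear (λ i → + 2 * (collides (lookup h i) r * (v i * x)))) σ ≡
  + 2 * (x * (countSketch (zip h σ) · v) r)
eval-linear-row []      []      v r x = sym (cong (_*_ (+ 2)) (*-zeroʳ x))
eval-linear-row (q ∷ h) (s ∷ σ) v r x = begin
  eval (linear (λ i → + 2 * (collides (lookup h i) r * (v (suc i) * x)))) σ
    + (s ◃ 1) * (+ 2 * (collides q r * (v zero * x)))
    ≡⟨ cong (_+ (s ◃ 1) * (+ 2 * (collides q r * (v zero * x)))) (eval-linear-row h σ (v ∘ suc) r x) ⟩
  + 2 * (x * y) + (s ◃ 1) * (+ 2 * (collides q r * (v zero * x)))
    ≡⟨ regroup x y (s ◃ 1) (collides q r) (v zero) ⟩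
  + 2 * (x * (collides q r * (s ◃ 1) * v zero + y))
    ≡⟨ cong (λ e → + 2 * (x * (e * v zero + y))) (if≡if1* (does (q Fin.≟ r)) (s ◃ 1)) ⟨
  + 2 * (x * (countSketch ((q , s) ∷ zip h σ) · v) r) ∎
  where
  open ≡-Reasoning
  y = (countSketch (zip h σ) · (v ∘ suc)) r
  regroup : ∀ x y s c v → + 2 * (x * y) + s * (+ 2 * (c * (v * x))) ≡ + 2 * (x * (c * s * v + y))
  regroup = solve-∀

‖0‖²≡0 : ∀ k → ‖ (λ (_ : Fin k) → 0ℤ) ‖² ≡ 0ℤ
‖0‖²≡0 zero    = refl
‖0‖²≡0 (suc k) = trans (+-identityˡ _) (‖0‖²≡0 k)

-- Adding a column alters the sketch in row `r` alone, so a single square has to be expanded.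
‖‖²-update : ∀ {k} (r : Fin k) c x (y : Fin k → ℤ) →
  ‖ (λ j → (if does (r Fin.≟ j) then c else 0ℤ) * x + y j) ‖² ≡
  ‖ y ‖² + (+ 2 * (c * x * y r) + (c * x) ²)
‖‖²-update {suc k} zero c x y =
  trans (cong (_+_ ((c * x + y zero) ²)) (sum-cong-≗ (λ j → cong _² (+-identityˡ (y (suc j))))))
    (expand c x (y zero) ‖ y ∘ suc ‖²)
  where
  expand : ∀ c x y z →
    (c * x + y) * (c * x + y) + z ≡ (y * y + z) + (+ 2 * (c * x * y) + (c * x) * (c * x))
  expand = solve-∀
‖‖²-update {suc k} (suc r) c x y =
  trans (cong₂ _+_ (cong _² (+-identityˡ (y zero))) (‖‖²-update r c x (y ∘ suc)))
    (sym (+-assoc (y zero ²) ‖ y ∘ suc ‖² (+ 2 * (c * x * y (suc r)) + (c * x) ²)))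

-- The diagonal terms carry squared signs, which are 1, so they cancel against ‖v‖². What is left
-- are the pairs of columns in a common row, collected one column at a time.
error≡quadratic : ∀ {k n} (h : Vec (Fin k) n) σ v →
  error (zip h σ) v ≡ eval (quadratic (collisions h v)) σ
error≡quadratic {k} []      []      v = trans (+-identityʳ _) (‖0‖²≡0 k)
error≡quadratic     (r ∷ h) (s ∷ σ) v = begin
  ‖ countSketch ((r , s) ∷ zip h σ) · v ‖² - ‖ v ‖²
    ≡⟨ cong (_- ‖ v ‖²) (‖‖²-update r (s ◃ 1) (v zero) y) ⟩
  ‖ y ‖² + (+ 2 * ((s ◃ 1) * v zero * y r) + ((s ◃ 1) * v zero) ²) - (v zero ² + ‖ v ∘ suc ‖²)
    ≡⟨ regroup ‖ y ‖² (s ◃ 1) (v zero) (y r) ‖ v ∘ suc ‖² ⟩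
  (‖ y ‖² - ‖ v ∘ suc ‖²) + (s ◃ 1) * (+ 2 * (v zero * y r)) + ((s ◃ 1) ² - 1ℤ) * v zero ²
    ≡⟨ cong (λ e → (‖ y ‖² - ‖ v ∘ suc ‖²) + (s ◃ 1) * (+ 2 * (v zero * y r)) + e * v zero ²) (sign² s) ⟩
  (‖ y ‖² - ‖ v ∘ suc ‖²) + (s ◃ 1) * (+ 2 * (v zero * y r)) + 0ℤ
    ≡⟨ +-identityʳ _ ⟩
  (‖ y ‖² - ‖ v ∘ suc ‖²) + (s ◃ 1) * (+ 2 * (v zero * y r))
    ≡⟨ cong₂ (λ a b → a + (s ◃ 1) * b)
         (error≡quadratic h σ (v ∘ suc)) (sym (eval-linear-row h σ (v ∘ suc) r (v zero))) ⟩
  eval (quadratic (collisions (r ∷ h) v)) (s ∷ σ) ∎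
  where
  open ≡-Reasoning
  y = countSketch (zip h σ) · (v ∘ suc)
  sign² : ∀ s → (s ◃ 1) ² - 1ℤ ≡ 0ℤ
  sign² Sign.+ = refl
  sign² Sign.- = refl
  regroup : ∀ a s x b c → a + (+ 2 * (s * x * b) + (s * x) * (s * x)) - (x * x + c) ≡
    (a - c) + s * (+ 2 * (x * b)) + (s * s - 1ℤ) * (x * x)
  regroup = solve-∀

-- Expected collision energy

∑-tabulate : ∀ {k} (f : Fin k → A) g → ∑ (tabulate f) g ≡ sum (λ i → g (f i))
∑-tabulate {k = zero}  f g = refl
∑-tabulate {k = suc k} f g = cong (_+_ (g (f zero))) (∑-tabulate (f ∘ suc) g)

∑-const-allFin : ∀ k c → ∑ (allFin k) (λ _ → c) ≡ + k * c
∑-const-allFin k c = trans (∑-const (allFin k) c) (cong (λ l → + l * c) (length-tabulate {n = k} id))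

sum-collides : ∀ {k} (r : Fin k) y → sum (λ j → collides r j * y) ≡ y
sum-collides {suc k} zero    y = trans (cong₂ _+_ (*-identityˡ y) (zeros k)) (+-identityʳ y)
  where
  zeros : ∀ k → sum (λ (_ : Fin k) → 0ℤ) ≡ 0ℤ
  zeros zero    = refl
  zeros (suc k) = trans (+-identityˡ _) (zeros k)
sum-collides {suc k} (suc r) y = trans (+-identityˡ _) (sum-collides r y)

-- An indicator is its own square, so the energy is linear in the collision indicators and can be
-- averaged over rows.
collides-square : ∀ {k} (r s : Fin k) x → (+ 2 * (collides r s * x)) ² ≡ collides r s * (+ 4 * x ²)
collides-square r s x = by-cases (does (r Fin.≟ s))
  where
  hit : ∀ x → (+ 2 * (1ℤ * x)) * (+ 2 * (1ℤ * x)) ≡ 1ℤ * (+ 4 * (x * x))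
  hit = solve-∀
  by-cases : ∀ b → (+ 2 * ((if b then 1ℤ else 0ℤ) * x)) ² ≡ (if b then 1ℤ else 0ℤ) * (+ 4 * x ²)
  by-cases true  = hit x
  by-cases false = refl

-- Each old column collides with exactly one choice of `r`, so it is counted once.
∑-norm²-linear-row : ∀ {k n} (h : Vec (Fin k) n) v x →
  ∑ (allFin k) (λ r → norm² (linear (λ i → + 2 * (collides (lookup h i) r * (v i * x))))) ≡
  + 4 * (x ² * ‖ v ‖²)
∑-norm²-linear-row {k} {zero}  []      v x =
  trans (trans (∑-const-allFin k 0ℤ) (*-zeroʳ (+ k))) (sym (cong (_*_ (+ 4)) (*-zeroʳ (x ²))))
∑-norm²-linear-row {k} {suc n} (q ∷ h) v x = begin
  ∑ (allFin k) (λ r → rest r + head r)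
    ≡⟨ ∑-distrib-+ (allFin k) rest head ⟩
  ∑ (allFin k) rest + ∑ (allFin k) head
    ≡⟨ cong₂ _+_ (∑-norm²-linear-row h (v ∘ suc) x) head-sum ⟩
  + 4 * (x ² * ‖ v ∘ suc ‖²) + + 4 * (v zero * x) ²
    ≡⟨ regroup x (v zero) ‖ v ∘ suc ‖² ⟩
  + 4 * (x ² * ‖ v ‖²) ∎
  where
  open ≡-Reasoning
  rest head : Fin k → ℤ
  rest r = norm² (linear (λ i → + 2 * (collides (lookup h i) r * (v (suc i) * x))))
  head r = (+ 2 * (collides q r * (v zero * x))) ²
  head-sum : ∑ (allFin k) head ≡ + 4 * (v zero * x) ²
  head-sum = trans (∑-cong (allFin k) (λ r → collides-square q r (v zero * x)))
    (trans (∑-tabulate id (λ r → collides q r * (+ 4 * (v zero * x) ²)))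
      (sum-collides q (+ 4 * (v zero * x) ²)))
  regroup : ∀ x v z → + 4 * ((x * x) * z) + + 4 * ((v * x) * (v * x)) ≡ + 4 * ((x * x) * (v * v + z))
  regroup = solve-∀

rows : ∀ k n → List (Vec (Fin k) n)
rows k n = vectors (allFin k) n

‖‖²-nonneg : ∀ {n} (v : Fin n → ℤ) → 0ℤ ≤ ‖ v ‖²
‖‖²-nonneg {zero}  v = ≤-refl
‖‖²-nonneg {suc n} v = 0≤+ (0≤x² (v zero)) (‖‖²-nonneg (v ∘ suc))

-- A pair i > j collides with probability 1/k and then contributes 4v_i²v_j²; the sum of these over
-- all pairs is at most 2‖v‖⁴. The resulting bound 2‖v‖⁴/k on the mean is multiplied by k^(n+1) to
-- stay in the integers.
collision-energy : ∀ {k n} (v : Fin n → ℤ) →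
  + k * ∑ (rows k n) (λ h → norm² (quadratic (collisions h v))) ≤ + 2 * (+ k) ^ n * ‖ v ‖² ²
collision-energy {k} {zero}  v = ≤-reflexive (*-zeroʳ (+ k))
collision-energy {k} {suc n} v = begin
  + k * ∑ (rows k (suc n)) (λ h → norm² (quadratic (collisions h v)))
    ≡⟨ cong (_*_ (+ k)) (trans (∑-cartesianProductWith _∷_ (allFin k) (rows k n) _)
         (∑-swap (allFin k) (rows k n) _)) ⟩
  + k * ∑ (rows k n) (λ h → ∑ (allFin k) (λ r → tail h + row h r))
    ≡⟨ cong (_*_ (+ k)) (∑-cong (rows k n) (λ h →
         trans (∑-distrib-+ (allFin k) (λ _ → tail h) (row h))
           (cong₂ _+_ (∑-const-allFin k (tail h))
             (∑-norm²-linear-row h (v ∘ suc) (v zero))))) ⟩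
  + k * ∑ (rows k n) (λ h → + k * tail h + + 4 * (v zero ² * Z))
    ≡⟨ cong (_*_ (+ k)) (trans (∑-distrib-+ (rows k n) (λ h → + k * tail h) (λ _ → + 4 * (v zero ² * Z)))
         (cong₂ _+_ (*-distribˡ-∑ (+ k) (rows k n) tail)
           (trans (∑-const (rows k n) _) (cong (_* (+ 4 * (v zero ² * Z)))
             (trans (length-vectors (allFin k) n) (cong (λ l → (+ l) ^ n) (length-tabulate id))))))) ⟩
  + k * (+ k * ∑ (rows k n) tail + (+ k) ^ n * (+ 4 * (v zero ² * Z)))
    ≤⟨ ≤-from-difference (budget (+ k) (∑ (rows k n) tail) ((+ k) ^ n) (v zero) Z)
         (0≤+ (0≤* {+ k} 0≤+n (i≤j⇒0≤j-i (collision-energy {k} (v ∘ suc))))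
              (0≤* {+ 2} 0≤+n (0≤* (0≤[+n]^ k (suc n)) (0≤x² (v zero ²))))) ⟩
  + 2 * (+ k) ^ suc n * ‖ v ‖² ² ∎
  where
  open ≤-Reasoning
  Z = ‖ v ∘ suc ‖²
  tail : Vec (Fin k) n → ℤ
  tail h = norm² (quadratic (collisions h (v ∘ suc)))
  row : Vec (Fin k) n → Fin k → ℤ
  row h r = norm² (linear (λ i → + 2 * (collides (lookup h i) r * (v (suc i) * v zero))))
  budget : ∀ k s p x z →
    + 2 * (k * p) * ((x * x + z) * (x * x + z)) - k * (k * s + p * (+ 4 * ((x * x) * z))) ≡
    k * (+ 2 * p * (z * z) - k * s) + + 2 * ((k * p) * ((x * x) * (x * x)))
  budget = solve-∀

-- Counting the outcomes of a bad event

-- Rows and signs are independent, so the signs can be summed first with the rows frozen.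
∑-outcomes : ∀ k n (F : Outcome k n → ℤ) →
  ∑ (outcomes k n) F ≡ ∑ (rows k n) (λ h → ∑ (vectors signs n) (λ σ → F (zip h σ)))
∑-outcomes k zero    F = sym (+-identityʳ (F [] + 0ℤ))
∑-outcomes k (suc n) F = begin
  ∑ (outcomes k (suc n)) F
    ≡⟨ ∑-cartesianProductWith _∷_ (cartesianProduct (allFin k) signs) (outcomes k n) F ⟩
  ∑ (cartesianProduct (allFin k) signs) (λ x → ∑ (outcomes k n) (λ ω → F (x ∷ ω)))
    ≡⟨ ∑-cartesianProductWith _,_ (allFin k) signs (λ x → ∑ (outcomes k n) (λ ω → F (x ∷ ω))) ⟩
  ∑ (allFin k) (λ r → ∑ signs (λ s → ∑ (outcomes k n) (λ ω → F ((r , s) ∷ ω))))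
    ≡⟨ ∑-cong (allFin k) (λ r → trans
         (∑-cong signs (λ s → ∑-outcomes k n (λ ω → F ((r , s) ∷ ω))))
         (trans (∑-swap signs (rows k n) (λ s h → ∑ (vectors signs n) (λ σ → F ((r , s) ∷ zip h σ))))
           (∑-cong (rows k n) (λ h →
             sym (∑-cartesianProductWith _∷_ signs (vectors signs n) (λ σ → F (zip (r ∷ h) σ))))))) ⟩
  ∑ (allFin k) (λ r → ∑ (rows k n) (λ h → ∑ (vectors signs (suc n)) (λ σ → F (zip (r ∷ h) σ))))
    ≡⟨ ∑-cartesianProductWith _∷_ (allFin k) (rows k n)
         (λ h → ∑ (vectors signs (suc n)) (λ σ → F (zip h σ))) ⟨
  ∑ (rows k (suc n)) (λ h → ∑ (vectors signs (suc n)) (λ σ → F (zip h σ))) ∎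
  where open ≡-Reasoning

indicator : ∀ {D : Pred A 0ℓ} → Decidable D → A → ℤ
indicator D? x = if does (D? x) then 1ℤ else 0ℤ

length-filter≡∑ : ∀ {D : Pred A 0ℓ} (D? : Decidable D) xs →
  + length (filter D? xs) ≡ ∑ xs (indicator D?)
length-filter≡∑ D? []       = refl
length-filter≡∑ D? (x ∷ xs) with does (D? x)
... | true  = cong (_+_ 1ℤ) (length-filter≡∑ D? xs)
... | false = trans (length-filter≡∑ D? xs) (sym (+-identityˡ _))

error-zero : ∀ {k n} (ω : Outcome k n) → error ω (λ _ → 0ℤ) ≡ 0ℤ
error-zero {k} {n} ω = cong₂ _-_
  (trans (sum-cong-≗ {k} (λ j → cong _² (trans (sum-cong-≗ (λ i → *-zeroʳ (countSketch ω j i)))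
    (sum-replicate-zero n)))) (‖0‖²≡0 k))
  (‖0‖²≡0 n)

collides-nonneg : ∀ {k} (r s : Fin k) → 0ℤ ≤ collides r s
collides-nonneg r s with does (r Fin.≟ s)
... | true  = 0≤+n
... | false = 0≤+n

-- The failure count for a nondecreasing family of vectors

module _ {n : ℕ} (f : ℕ → Fin n → ℤ) (m : ℕ)
  (f₀≡0 : f 0 ≡ (λ _ → 0ℤ))
  (f-nonneg : ∀ t i → 0ℤ ≤ f t i)
  (f-mono : ∀ {s t} → s ℕ.≤ t → ∀ i → f s i ≤ f t i)
  where

  module _ {k : ℕ} (h : Vec (Fin k) n) where

    coefficients : ℕ → Fin n → Fin n → ℤ
    coefficients t = collisions h (f t)

    coefficients-nonneg : ∀ t i j → 0ℤ ≤ coefficients t i j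
    coefficients-nonneg t i j = 0≤* {+ 2} 0≤+n
      (0≤* (collides-nonneg (lookup h i) (lookup h j)) (0≤* (f-nonneg t i) (f-nonneg t j)))

    coefficients-mono : ∀ {s t} → s ℕ.≤ t → ∀ i j → coefficients s i j ≤ coefficients t i j
    coefficients-mono {s} {t} s≤t i j = *-monoˡ {+ 2} 0≤+n
      (*-monoˡ (collides-nonneg (lookup h i) (lookup h j))
        (*-mono-≤ (f-nonneg s i) (f-nonneg t j) (f-mono s≤t i) (f-mono s≤t j)))

    -- The variance of the error over the signs for fixed rows; it takes the role of `μ` in
    -- `maximal`.
    energy : ℕ → ℤ
    energy t = norm² (quadratic (coefficients t))

    energy-nonneg : ∀ t → 0ℤ ≤ energy t
    energy-nonneg t = norm²-nonneg (quadratic (coefficients t))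

    increment : ℕ → ℕ → Chaos 2 n
    increment s t = quadratic (λ i j → coefficients t i j - coefficients s i j)

    norm²-increment : ∀ {s t} → s ℕ.≤ t → norm² (increment s t) ≤ energy t - energy s
    norm²-increment {s} {t} s≤t = norm²-quadratic-- (coefficients t) (coefficients s)
      (coefficients-nonneg s) (coefficients-mono s≤t)

    energy-mono : ∀ {s t} → s ℕ.≤ t → energy s ≤ energy t
    energy-mono {s} {t} s≤t =
      0≤i-j⇒j≤i (≤-trans (norm²-nonneg (increment s t)) (norm²-increment s≤t))

    -- The constant of `hypercontractivity` in degree 2.
    scale : ℤ
    scale = (+ 9) ^ 2 * (+ 2) ^ n

    0≤scale : 0ℤ ≤ scale
    0≤scale = 0≤* {(+ 9) ^ 2} 0≤+n (0≤[+n]^ 2 n)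

    errorAt : ℕ → Vec Sign n → ℤ
    errorAt t σ = error (zip h σ) (f t)

    increments : ∀ {s t} → s ℕ.≤ t →
      ∑ (vectors signs n) (λ σ → (errorAt t σ - errorAt s σ) ⁴) ≤ scale * (energy t - energy s) ²
    increments {s} {t} s≤t = begin
      ∑ (vectors signs n) (λ σ → (errorAt t σ - errorAt s σ) ⁴)
        ≡⟨ ∑-cong (vectors signs n) (λ σ → cong _⁴ (trans
             (cong₂ _-_ (error≡quadratic h σ (f t)) (error≡quadratic h σ (f s)))
             (sym (eval-quadratic-- (coefficients t) (coefficients s) σ)))) ⟩
      ∑ (vectors signs n) (λ σ → eval (increment s t) σ ⁴)
        ≤⟨ hypercontractivity (increment s t) ⟩
      scale * norm² (increment s t) ²
        ≤⟨ *-monoˡ 0≤scale (*-mono-≤ 0≤N (≤-trans 0≤N N≤) N≤ N≤) ⟩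
      scale * (energy t - energy s) ² ∎
      where
      open ≤-Reasoning
      N≤ = norm²-increment s≤t
      0≤N = norm²-nonneg (increment s t)

    -- `maximal` on [0, m]. The error vanishes at time 0, so increments from the start are the
    -- errors themselves.
    fourth-moment : ∀ (τ : Vec Sign n → ℕ) → (∀ σ → τ σ ℕ.≤ m) →
      ∑ (vectors signs n) (λ σ → errorAt (τ σ) σ ⁴) ≤ + 500 * scale * energy m ²
    fourth-moment τ τ≤m = begin
      ∑ (vectors signs n) (λ σ → errorAt (τ σ) σ ⁴)
        ≡⟨ ∑-cong (vectors signs n) (λ σ → cong _⁴ (from-start σ)) ⟩
      ∑ (vectors signs n) (λ σ → (errorAt (τ σ) σ - errorAt 0 σ) ⁴)
        ≤⟨ maximal (vectors signs n) errorAt energy scale 0≤scale energy-mono increments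
             m ℕ.z≤n (ℕ.≤-reflexive (sym (ℕ.+-identityʳ m))) τ (λ _ → ℕ.z≤n) τ≤m ⟩
      + 500 * scale * (energy m - energy 0) ²
        ≤⟨ *-monoˡ (0≤* {+ 500} 0≤+n 0≤scale)
             (*-mono-≤ 0≤gain (energy-nonneg m) gain≤ gain≤) ⟩
      + 500 * scale * energy m ² ∎
      where
      open ≤-Reasoning
      0≤gain : 0ℤ ≤ energy m - energy 0
      0≤gain = i≤j⇒0≤j-i (energy-mono ℕ.z≤n)
      cancel : ∀ x y → x - (x - y) ≡ y
      cancel = solve-∀
      gain≤ : energy m - energy 0 ≤ energy m
      gain≤ = ≤-from-difference (cancel (energy m) (energy 0)) (energy-nonneg 0)
      from-start : ∀ σ → errorAt (τ σ) σ ≡ errorAt (τ σ) σ - errorAt 0 σ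
      from-start σ = sym (trans
        (cong (errorAt (τ σ) σ -_) (trans (cong (error (zip h σ)) f₀≡0) (error-zero (zip h σ))))
        (+-identityʳ (errorAt (τ σ) σ)))

    -- Squaring N (pF)² and using N ≤ 2ⁿ turns the fourth-moment bound into a
    -- second-moment one, which is linear in the energy and can be averaged over h.
    sign-count : ∀ (χ : Vec Sign n → ℤ) (τ : Vec Sign n → ℕ) (p q : ℤ) →
      (∀ σ → 0ℤ ≤ χ σ) → (∀ σ → χ σ ≤ 1ℤ) → (∀ σ → τ σ ℕ.≤ m) →
      (∀ σ → χ σ * p ⁴ ≤ (q * errorAt (τ σ) σ) ⁴) →
      ∑ (vectors signs n) χ * p ² ≤ + 202 * ((+ 2) ^ n * q ² * energy m)
    sign-count χ τ p q 0≤χ χ≤1 τ≤m markov = x²≤y²⇒x≤y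
      (0≤* {+ 202} 0≤+n (0≤* (0≤* (0≤[+n]^ 2 n) (0≤x² q)) (energy-nonneg m))) (begin
      (N * p ²) ²
        ≡⟨ regroup N p ⟩
      N * (N * p ⁴)
        ≤⟨ *-mono-≤ 0≤N 0≤bound N≤2ⁿ Np⁴≤bound ⟩
      (+ 2) ^ n * (q ⁴ * (+ 500 * scale * energy m ²))
        -- The constant is a rounded-up square root: 202² = 40804 = 500 · 81 + 304.
        ≤⟨ ≤-from-difference (gap ((+ 2) ^ n) q (energy m))
             (0≤* {+ 304} 0≤+n (0≤x² ((+ 2) ^ n * q ² * energy m))) ⟩
      (+ 202 * ((+ 2) ^ n * q ² * energy m)) ² ∎)
      where
      open ≤-Reasoning
      Σσ = vectors signs n
      N = ∑ Σσ χ
      0≤N : 0ℤ ≤ N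
      0≤N = ∑-nonneg Σσ 0≤χ
      N≤2ⁿ : N ≤ (+ 2) ^ n
      N≤2ⁿ = ≤-trans (∑-mono-≤ Σσ χ≤1)
        (≤-reflexive (trans (∑-const Σσ 1ℤ) (trans (*-identityʳ _) (length-vectors signs n))))
      0≤bound : 0ℤ ≤ q ⁴ * (+ 500 * scale * energy m ²)
      0≤bound = 0≤* (0≤x² (q ²)) (0≤* (0≤* {+ 500} 0≤+n 0≤scale) (0≤x² (energy m)))
      product⁴ : ∀ q x → ((q * x) * (q * x)) * ((q * x) * (q * x)) ≡
        ((q * q) * (q * q)) * ((x * x) * (x * x))
      product⁴ = solve-∀
      Np⁴≤bound : N * p ⁴ ≤ q ⁴ * (+ 500 * scale * energy m ²)
      Np⁴≤bound = begin
        N * p ⁴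
          ≡⟨ *-comm N (p ⁴) ⟩
        p ⁴ * N
          ≡⟨ *-distribˡ-∑ (p ⁴) Σσ χ ⟨
        ∑ Σσ (λ σ → p ⁴ * χ σ)
          ≤⟨ ∑-mono-≤ Σσ (λ σ → ≤-trans (≤-reflexive (*-comm (p ⁴) (χ σ))) (≤-trans (markov σ)
               (≤-reflexive (product⁴ q (errorAt (τ σ) σ))))) ⟩
        ∑ Σσ (λ σ → q ⁴ * errorAt (τ σ) σ ⁴)
          ≡⟨ *-distribˡ-∑ (q ⁴) Σσ (λ σ → errorAt (τ σ) σ ⁴) ⟩
        q ⁴ * ∑ Σσ (λ σ → errorAt (τ σ) σ ⁴)
          ≤⟨ *-monoˡ (0≤x² (q ²)) (fourth-moment τ τ≤m) ⟩
        q ⁴ * (+ 500 * scale * energy m ²) ∎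
      regroup : ∀ N p → (N * (p * p)) * (N * (p * p)) ≡ N * (N * ((p * p) * (p * p)))
      regroup = solve-∀
      gap : ∀ T q A →
        (+ 202 * (T * (q * q) * A)) * (+ 202 * (T * (q * q) * A)) -
          T * (((q * q) * (q * q)) * (+ 500 * (+ 81 * T) * (A * A))) ≡
        + 304 * ((T * (q * q) * A) * (T * (q * q) * A))
      gap = solve-∀

  -- With p / q in the place of ε this reads k ε² Pr ≤ 404, denominators cleared. `sign-count` is
  -- applied for each choice of rows with threshold `p * F`, then `collision-energy` averages over
  -- the rows; the common factor `F ²` cancels as it is positive.
  failure-count : ∀ {k} {D : Pred (Outcome k n) 0ℓ} (D? : Decidable D) (p q : ℤ) →
    0ℤ < ‖ f m ‖² →
    (∀ ω → D ω → ∃[ t ] (t ℕ.≤ m × (p * ‖ f m ‖²) ² ≤ (q * error ω (f t)) ²)) →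
    + k * + length (filter D? (outcomes k n)) * p ² ≤ + 404 * ((+ k) ^ n * (+ 2) ^ n * q ²)
  failure-count {k} {D} D? p q 0<F fails =
    *-cancelʳ-≤-pos _ _ (F ²) {{positive (*-monoʳ-<-pos F {{positive 0<F}} 0<F)}} (begin
    + k * + length (filter D? (outcomes k n)) * p ² * F ²
      ≡⟨ regroup₁ (+ k) (+ length (filter D? (outcomes k n))) p F ⟩
    + k * ((p * F) ² * + length (filter D? (outcomes k n)))
      ≡⟨ cong (λ N → + k * ((p * F) ² * N))
           (trans (length-filter≡∑ D? (outcomes k n)) (∑-outcomes k n (indicator D?))) ⟩
    + k * ((p * F) ² * ∑ (rows k n) count)
      ≡⟨ cong (_*_ (+ k)) (*-distribˡ-∑ ((p * F) ²) (rows k n) count) ⟨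
    + k * ∑ (rows k n) (λ h → (p * F) ² * count h)
      ≤⟨ *-monoˡ {+ k} 0≤+n (∑-mono-≤ (rows k n) row-bound) ⟩
    + k * ∑ (rows k n) (λ h → + 202 * ((+ 2) ^ n * q ²) * energy h m)
      ≡⟨ cong (_*_ (+ k)) (*-distribˡ-∑ (+ 202 * ((+ 2) ^ n * q ²)) (rows k n) (λ h → energy h m)) ⟩
    + k * (+ 202 * ((+ 2) ^ n * q ²) * ∑ (rows k n) (λ h → energy h m))
      ≡⟨ regroup₂ (+ k) ((+ 2) ^ n) q (∑ (rows k n) (λ h → energy h m)) ⟩
    + 202 * ((+ 2) ^ n * q ²) * (+ k * ∑ (rows k n) (λ h → energy h m))
      ≤⟨ *-monoˡ (0≤* {+ 202} 0≤+n (0≤* (0≤[+n]^ 2 n) (0≤x² q))) (collision-energy {k} (f m)) ⟩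
    + 202 * ((+ 2) ^ n * q ²) * (+ 2 * (+ k) ^ n * F ²)
      ≡⟨ regroup₃ ((+ 2) ^ n) q ((+ k) ^ n) F ⟩
    + 404 * ((+ k) ^ n * (+ 2) ^ n * q ²) * F ² ∎)
    where
    open ≤-Reasoning
    F = ‖ f m ‖²
    count : Vec (Fin k) n → ℤ
    count h = ∑ (vectors signs n) (λ σ → indicator D? (zip h σ))
    -- The witnessing time of a bad outcome. The default 0 is harmless because the indicator
    -- vanishes there.
    time : ∀ {ω} → Dec (D ω) → ℕ
    time {ω} (yes d) = proj₁ (fails ω d)
    time     (no _)  = 0
    time≤m : ∀ {ω} (d? : Dec (D ω)) → time d? ℕ.≤ m
    time≤m {ω} (yes d) = proj₁ (proj₂ (fails ω d))
    time≤m     (no _)  = ℕ.z≤n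
    markov : ∀ {ω} (d? : Dec (D ω)) →
      (if does d? then 1ℤ else 0ℤ) * (p * F) ⁴ ≤ (q * error ω (f (time d?))) ⁴
    markov {ω} (yes d) = ≤-trans (≤-reflexive (*-identityˡ ((p * F) ⁴)))
      (*-mono-≤ (0≤x² (p * F)) (0≤x² (q * error ω (f (proj₁ (fails ω d))))) bound bound)
      where bound = proj₂ (proj₂ (fails ω d))
    markov {ω} (no _) = 0≤x² ((q * error ω (f 0)) ²)
    0≤indicator : ∀ {ω} (d? : Dec (D ω)) → 0ℤ ≤ (if does d? then 1ℤ else 0ℤ)
    0≤indicator (yes _) = 0≤+n
    0≤indicator (no _)  = 0≤+n
    indicator≤1 : ∀ {ω} (d? : Dec (D ω)) → (if does d? then 1ℤ else 0ℤ) ≤ 1ℤ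
    indicator≤1 (yes _) = ≤-refl
    indicator≤1 (no _)  = 0≤+n
    row-bound : ∀ h → (p * F) ² * count h ≤ + 202 * ((+ 2) ^ n * q ²) * energy h m
    row-bound h = ≤-trans (≤-reflexive (*-comm ((p * F) ²) (count h)))
      (≤-trans (sign-count h (λ σ → indicator D? (zip h σ)) (λ σ → time (D? (zip h σ))) (p * F) q
          (λ σ → 0≤indicator (D? (zip h σ))) (λ σ → indicator≤1 (D? (zip h σ)))
          (λ σ → time≤m (D? (zip h σ))) (λ σ → markov (D? (zip h σ))))
        (≤-reflexive (sym (*-assoc (+ 202) ((+ 2) ^ n * q ²) (energy h m)))))
    regroup₁ : ∀ k N p F → k * N * (p * p) * (F * F) ≡ k * ((p * F) * (p * F) * N)
    regroup₁ = solve-∀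
    regroup₂ : ∀ k T q E → k * (+ 202 * (T * (q * q)) * E) ≡ + 202 * (T * (q * q)) * (k * E)
    regroup₂ = solve-∀
    regroup₃ : ∀ T q K F →
      + 202 * (T * (q * q)) * (+ 2 * K * (F * F)) ≡ + 404 * (K * T * (q * q)) * (F * F)
    regroup₃ = solve-∀

-- Frequency vectors

freq-mono : ∀ {n} (a : List (Fin n)) {s t} → s ℕ.≤ t → ∀ i → freq a s i ≤ freq a t i
freq-mono a s≤t i = +≤+ (count-mono a s≤t)
  where
  count-mono : ∀ a {s t} → s ℕ.≤ t →
    length (filter (Fin._≟ i) (take s a)) ℕ.≤ length (filter (Fin._≟ i) (take t a))
  count-mono a       {zero}           s≤t         = ℕ.z≤n
  count-mono []      {suc s} {suc t}  s≤t         = ℕ.z≤n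
  count-mono (x ∷ a) {suc s} {suc t}  (ℕ.s≤s s≤t) with does (x Fin.≟ i)
  ... | true  = ℕ.s≤s (count-mono a s≤t)
  ... | false = count-mono a s≤t

coordinate²≤‖‖² : ∀ {n} (v : Fin n → ℤ) i → v i ² ≤ ‖ v ‖²
coordinate²≤‖‖² v zero    = ≤-trans (≤-reflexive (sym (+-identityʳ (v zero ²))))
  (+-monoʳ-≤ (v zero ²) (‖‖²-nonneg (v ∘ suc)))
coordinate²≤‖‖² v (suc i) = ≤-trans (coordinate²≤‖‖² (v ∘ suc) i)
  (≤-trans (≤-reflexive (sym (+-identityˡ ‖ v ∘ suc ‖²))) (+-monoˡ-≤ ‖ v ∘ suc ‖² (0≤x² (v zero))))

-- The coordinate of the first item is at least 1. Positivity is what lets `failure-count` cancel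
-- the squared norm.
‖freq‖²-positive : ∀ {n} (x : Fin n) a → 0ℤ < ‖ freq (x ∷ a) (length (x ∷ a)) ‖²
‖freq‖²-positive x a = <-≤-trans 0<fₓ² (coordinate²≤‖‖² (freq (x ∷ a) (length (x ∷ a))) x)
  where
  0<fₓ² : 0ℤ < freq (x ∷ a) (length (x ∷ a)) x ²
  0<fₓ² = subst (λ l → 0ℤ < (+ length l) ²)
    (sym (filter-accept (Fin._≟ x) {xs = take (length a) a} refl)) (+<+ (ℕ.s≤s ℕ.z≤n))

-- Integers as rationals

ι : ℤ → ℚ
ι z = z ℚ./ 1

-- Unnormalised rationals carry no gcd reduction, so the facts about `ι` are checked there by cross
-- multiplication and transferred.
toℚᵘ-ι : ∀ z → ℚ.toℚᵘ (ι z) ℚᵘ.≃ ℚᵘ.mkℚᵘ z 0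
toℚᵘ-ι z = ℚ.toℚᵘ-fromℚᵘ (ℚᵘ.mkℚᵘ z 0)

/-*-cancel : ∀ z d .{{_ : NonZero d}} → (z ℚ./ d) ℚ.* ι (+ d) ≡ ι z
/-*-cancel z (suc d) = ℚ.toℚᵘ-injective (begin
  ℚ.toℚᵘ ((z ℚ./ suc d) ℚ.* ι (+ suc d))
    ≈⟨ ℚ.toℚᵘ-homo-* (z ℚ./ suc d) (ι (+ suc d)) ⟩
  ℚ.toℚᵘ (z ℚ./ suc d) ℚᵘ.* ℚ.toℚᵘ (ι (+ suc d))
    ≈⟨ ℚᵘ.*-cong (ℚ.toℚᵘ-fromℚᵘ (ℚᵘ.mkℚᵘ z d)) (toℚᵘ-ι (+ suc d)) ⟩
  ℚᵘ.mkℚᵘ z d ℚᵘ.* ℚᵘ.mkℚᵘ (+ suc d) 0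
    ≈⟨ ℚᵘ.*≡* (trans (*-identityʳ (z * + suc d)) (cong (λ e → z * + e) (sym (ℕ.*-identityʳ (suc d))))) ⟩
  ℚᵘ.mkℚᵘ z 0
    ≈⟨ toℚᵘ-ι z ⟨
  ℚ.toℚᵘ (ι z) ∎)
  where open ℚᵘ.≃-Reasoning

ι-* : ∀ x y → ι (x * y) ≡ ι x ℚ.* ι y
ι-* x y = ℚ.toℚᵘ-injective (begin
  ℚ.toℚᵘ (ι (x * y))
    ≈⟨ toℚᵘ-ι (x * y) ⟩
  ℚᵘ.mkℚᵘ x 0 ℚᵘ.* ℚᵘ.mkℚᵘ y 0
    ≈⟨ ℚᵘ.*-cong (toℚᵘ-ι x) (toℚᵘ-ι y) ⟨
  ℚ.toℚᵘ (ι x) ℚᵘ.* ℚ.toℚᵘ (ι y)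
    ≈⟨ ℚ.toℚᵘ-homo-* (ι x) (ι y) ⟨
  ℚ.toℚᵘ (ι x ℚ.* ι y) ∎)
  where open ℚᵘ.≃-Reasoning

ι-mono-≤ : ∀ {x y} → x ≤ y → ι x ℚ.≤ ι y
ι-mono-≤ {x} {y} x≤y = ℚ.toℚᵘ-cancel-≤
  (ℚᵘ.≤-respˡ-≃ (ℚᵘ.≃-sym (toℚᵘ-ι x)) (ℚᵘ.≤-respʳ-≃ (ℚᵘ.≃-sym (toℚᵘ-ι y))
    (ℚᵘ.*≤* (*-monoʳ-≤-nonNeg 1ℤ x≤y))))

ι-cancel-≤ : ∀ {x y} → ι x ℚ.≤ ι y → x ≤ y
ι-cancel-≤ {x} {y} ιx≤ιy = cancel
  (ℚᵘ.≤-respˡ-≃ (toℚᵘ-ι x) (ℚᵘ.≤-respʳ-≃ (toℚᵘ-ι y) (ℚ.toℚᵘ-mono-≤ ιx≤ιy)))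
  where
  cancel : ℚᵘ.mkℚᵘ x 0 ℚᵘ.≤ ℚᵘ.mkℚᵘ y 0 → x ≤ y
  cancel (ℚᵘ.*≤* x*1≤y*1) = *-cancelʳ-≤-pos x y 1ℤ x*1≤y*1

ι-positive : ∀ d .{{_ : NonZero d}} → ℚ.Positive (ι (+ d))
ι-positive d = ℚ.normalize-pos d 1

numerator : ∀ x → x ℚ.* ι (↧ x) ≡ ι (↥ x)
numerator x = trans (cong (ℚ._* ι (↧ x)) (sym (ℚ.↥p/↧p≡p x))) (/-*-cancel (↥ x) (↧ₙ x))

-- Probabilities

-- Lets a bound over the finite list `outcomes` apply to every outcome.
outcomes-complete : ∀ {k n} (ω : Outcome k n) → ω ∈ outcomes k n
outcomes-complete []            = here refl
outcomes-complete ((r , s) ∷ ω) = ∈-cartesianProductWith⁺ _∷_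
  (∈-cartesianProduct⁺ (∈-allFin r) (∈-signs s)) (outcomes-complete ω)
  where
  ∈-signs : ∀ s → s ∈ signs
  ∈-signs Sign.+ = here refl
  ∈-signs Sign.- = there (here refl)

upper-bound : ∀ (N : A → ℕ) xs → ∃[ B ] (∀ {x} → x ∈ xs → N x ℕ.≤ B)
upper-bound N []       = 0 , λ ()
upper-bound N (y ∷ xs) with upper-bound N xs
... | B , N≤B = N y ℕ.⊔ B , λ
  { (here refl)  → ℕ.m≤m⊔n (N y) B
  ; (there x∈xs) → ℕ.≤-trans (N≤B x∈xs) (ℕ.m≤n⊔m (N y) B) }

outcome-count : ∀ k n → + ((k ℕ.* 2) ℕ.^ n) ≡ (+ k) ^ n * (+ 2) ^ n
outcome-count k zero    = refl
outcome-count k (suc n) = trans (pos-* (k ℕ.* 2) ((k ℕ.* 2) ℕ.^ n))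
  (trans (cong₂ _*_ (pos-* k 2) (outcome-count k n)) (regroup (+ k) (+ 2) ((+ k) ^ n) ((+ 2) ^ n)))
  where
  regroup : ∀ k t K T → k * t * (K * T) ≡ k * K * (t * T)
  regroup = solve-∀

-- The trace of `TrackingFails` at a single late index of the sequence of ε: a rational threshold
-- and a non-strict inequality.
Fails : ∀ {k n} → ℚ → List (Fin n) → Pred (Outcome k n) 0ℓ
Fails e a ω = ∃[ t ] (1 ℕ.≤ t × t ℕ.≤ length a ×
  e ℚ.* ι ‖ freq a (length a) ‖² ℚ.≤ ι (+ ℤ.∣ error ω (freq a t) ∣))

∣x∣² : ∀ x → (+ ℤ.∣ x ∣) ² ≡ x ²
∣x∣² (+ n)    = refl
∣x∣² -[1+ n ] = refl

-- The empty stream has no time to fail at. Any other has positive final norm, and `failure-count`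
-- applies with p / q the reduced form of `e`.
failure-count-ℚ : ∀ {k n} (e : ℚ) → 0ℚ ℚ.≤ e → (a : List (Fin n)) →
  ∀ {D : Pred (Outcome k n) 0ℓ} (D? : Decidable D) → D ⊆ Fails e a →
  + k * + length (filter D? (outcomes k n)) * (↥ e) ² ≤ + 404 * ((+ k) ^ n * (+ 2) ^ n * (↧ e) ²)
failure-count-ℚ {k} {n} e 0≤e [] {D} D? D⊆Fails =
  ≤-trans (≤-reflexive (trans
      (cong (λ l → + k * + length l * (↥ e) ²) (filter-none D? {xs = outcomes k n} (All.tabulate (λ _ → impossible))))
      (cong (_* (↥ e) ²) (*-zeroʳ (+ k)))))
    (0≤* {+ 404} 0≤+n (0≤* (0≤* (0≤[+n]^ k n) (0≤[+n]^ 2 n)) (0≤x² (↧ e))))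
  where
  impossible : ∀ {ω} → ¬ D ω
  impossible d = contradiction (D⊆Fails d) λ { (t , 1≤t , t≤0 , _) → ℕ.<⇒≱ 1≤t t≤0 }
failure-count-ℚ {k} {n} e 0≤e a@(x ∷ b) {D} D? D⊆Fails =
  failure-count (freq a) (length a) refl (λ _ _ → 0≤+n) (freq-mono a) D? (↥ e) (↧ e)
    (‖freq‖²-positive x b) λ ω d → bound ω (D⊆Fails d)
  where
  F = ‖ freq a (length a) ‖²
  0≤↥e : 0ℤ ≤ ↥ e
  0≤↥e = ι-cancel-≤ (subst₂ ℚ._≤_ (ℚ.*-zeroˡ (ι (↧ e))) (numerator e)
    (ℚ.*-monoʳ-≤-nonNeg (ι (↧ e)) {{ℚ.pos⇒nonNeg (ι (↧ e)) {{ι-positive (↧ₙ e)}}}} 0≤e))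
  bound : ∀ ω → Fails e a ω →
    ∃[ t ] (t ℕ.≤ length a × (↥ e * F) ² ≤ (↧ e * error ω (freq a t)) ²)
  bound ω (t , _ , t≤m , eF≤X) = t , t≤m ,
    ≤-trans (*-mono-≤ (0≤* 0≤↥e (‖‖²-nonneg (freq a (length a)))) (0≤* {↧ e} 0≤+n 0≤+n) pF≤qX pF≤qX)
      (≤-reflexive (trans (square (↧ e) (+ ℤ.∣ X ∣))
        (trans (cong ((↧ e) ² *_) (∣x∣² X)) (sym (square (↧ e) X)))))
    where
    X = error ω (freq a t)
    square : ∀ q x → (q * x) * (q * x) ≡ (q * q) * (x * x)
    square = solve-∀
    open ℚ.≤-Reasoning
    swap : ∀ x y z → x ℚ.* y ℚ.* z ≡ x ℚ.* z ℚ.* y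
    swap = solve 3 (λ x y z → x :* y :* z := x :* z :* y) refl where open +-*-Solver
    pF≤qX : ↥ e * F ≤ ↧ e * + ℤ.∣ X ∣
    pF≤qX = ι-cancel-≤ (begin
      ι (↥ e * F)                    ≡⟨ ι-* (↥ e) F ⟩
      ι (↥ e) ℚ.* ι F                ≡⟨ cong (ℚ._* ι F) (numerator e) ⟨
      e ℚ.* ι (↧ e) ℚ.* ι F          ≡⟨ swap e (ι (↧ e)) (ι F) ⟩
      e ℚ.* ι F ℚ.* ι (↧ e)          ≤⟨ ℚ.*-monoʳ-≤-nonNeg (ι (↧ e))
                                          {{ℚ.pos⇒nonNeg (ι (↧ e)) {{ι-positive (↧ₙ e)}}}} eF≤X ⟩
      ι (+ ℤ.∣ X ∣) ℚ.* ι (↧ e)      ≡⟨ ℚ.*-comm (ι (+ ℤ.∣ X ∣)) (ι (↧ e)) ⟩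
      ι (↧ e) ℚ.* ι (+ ℤ.∣ X ∣)      ≡⟨ ι-* (↧ e) (+ ℤ.∣ X ∣) ⟨
      ι (↧ e * + ℤ.∣ X ∣)            ∎)

-- Multiplying by the number of outcomes and by the squared denominator of `e`, both positive,
-- reduces this to the integer count.
failure-probability : ∀ {k n} .{{_ : NonZero k}} (e : ℚ) → 0ℚ ℚ.≤ e → (a : List (Fin n)) →
  ∀ {D : Pred (Outcome k n) 0ℓ} (D? : Decidable D) → D ⊆ Fails e a →
  ι (+ k) ℚ.* (e ℚ.* e ℚ.* Pr D?) ℚ.≤ ι (+ 404)
failure-probability {k} {n} e 0≤e a D? D⊆Fails =
  ℚ.*-cancelʳ-≤-pos (M ℚ.* (q ℚ.* q)) {{ℚ.pos*pos⇒pos M {{M>0}} (q ℚ.* q) {{ℚ.pos*pos⇒pos q {{q>0}} q {{q>0}}}}}} (begin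
    ι (+ k) ℚ.* (e ℚ.* e ℚ.* Pr D?) ℚ.* (M ℚ.* (q ℚ.* q))
      ≡⟨ regroup (ι (+ k)) e (Pr D?) M q ⟩
    ι (+ k) ℚ.* (Pr D? ℚ.* M) ℚ.* ((e ℚ.* q) ℚ.* (e ℚ.* q))
      ≡⟨ cong₂ (λ x y → ι (+ k) ℚ.* x ℚ.* (y ℚ.* y)) (/-*-cancel (+ N) size) (numerator e) ⟩
    ι (+ k) ℚ.* ι (+ N) ℚ.* (ι (↥ e) ℚ.* ι (↥ e))
      ≡⟨ cong₂ ℚ._*_ (ι-* (+ k) (+ N)) (ι-* (↥ e) (↥ e)) ⟨
    ι (+ k * + N) ℚ.* ι ((↥ e) ²)
      ≡⟨ ι-* (+ k * + N) ((↥ e) ²) ⟨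
    ι (+ k * + N * (↥ e) ²)
      ≤⟨ ι-mono-≤ (failure-count-ℚ e 0≤e a D? D⊆Fails) ⟩
    ι (+ 404 * ((+ k) ^ n * (+ 2) ^ n * (↧ e) ²))
      ≡⟨ cong (λ s → ι (+ 404 * (s * (↧ e) ²))) (outcome-count k n) ⟨
    ι (+ 404 * (+ size * (↧ e) ²))
      ≡⟨ ι-* (+ 404) (+ size * (↧ e) ²) ⟩
    ι (+ 404) ℚ.* ι (+ size * (↧ e) ²)
      ≡⟨ cong (ι (+ 404) ℚ.*_) (trans (ι-* (+ size) ((↧ e) ²)) (cong (M ℚ.*_) (ι-* (↧ e) (↧ e)))) ⟩
    ι (+ 404) ℚ.* (M ℚ.* (q ℚ.* q)) ∎)
  where
  open ℚ.≤-Reasoning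
  N size : ℕ
  N = length (filter D? (outcomes k n))
  size = (k ℕ.* 2) ℕ.^ n
  instance
    size≢0 : NonZero size
    size≢0 = ℕ.m^n≢0 (k ℕ.* 2) n {{ℕ.m*n≢0 k 2}}
  M q : ℚ
  M = ι (+ size)
  q = ι (↧ e)
  M>0 : ℚ.Positive M
  M>0 = ι-positive size
  q>0 : ℚ.Positive q
  q>0 = ι-positive (↧ₙ e)
  regroup : ∀ k e p m q → k ℚ.* (e ℚ.* e ℚ.* p) ℚ.* (m ℚ.* (q ℚ.* q)) ≡
    k ℚ.* (p ℚ.* m) ℚ.* ((e ℚ.* q) ℚ.* (e ℚ.* q))
  regroup = solve 5 (λ k e p m q → k :* (e :* e :* p) :* (m :* (q :* q)) :=
    k :* (p :* m) :* ((e :* q) :* (e :* q))) refl where open +-*-Solver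

-- The finitely many failing outcomes share an index from which on all their
-- defining inequalities hold, so the real ε may be replaced by one rational term.
eventually-fails : ∀ {k n} (ε : ℝ) (a : List (Fin n)) →
  ∀ {D : Pred (Outcome k n) 0ℓ} (D? : Decidable D) → D ⊆ TrackingFails ε a →
  ∃[ N ] (∀ i → N ℕ.≤ i → D ⊆ Fails (seq ε i) a)
eventually-fails {k} {n} ε a {D} D? D⊆fails = N₀ , λ i N₀≤i {ω} d →
  fails-from (D? ω) i (ℕ.≤-trans (threshold≤N₀ (outcomes-complete ω)) N₀≤i) d
  where
  -- The index from which the strict real inequality witnessing this failure holds termwise.
  threshold : ∀ {ω} → Dec (D ω) → ℕ
  threshold (yes d) = let _ , _ , _ , _ , _ , N , _ = D⊆fails d in N
  threshold (no _)  = 0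
  bounded : ∃[ N ] (∀ {ω} → ω ∈ outcomes k n → threshold (D? ω) ℕ.≤ N)
  bounded = upper-bound (λ ω → threshold (D? ω)) (outcomes k n)
  N₀ = proj₁ bounded
  threshold≤N₀ = proj₂ bounded
  fails-from : ∀ {ω} (d? : Dec (D ω)) i → threshold d? ℕ.≤ i → D ω → Fails (seq ε i) a ω
  fails-from (no ¬d) i N≤i d = contradiction d ¬d
  fails-from {ω} (yes d) i N≤i _ =
    let t , 1≤t , t≤m , q , 0<q , N , gap = D⊆fails d
    in t , 1≤t , t≤m , drop q 0<q (gap i N≤i)
    where
    drop : ∀ {x y} q → 0ℚ ℚ.< q → x ℚ.+ q ℚ.≤ y → x ℚ.≤ y
    drop {x} q 0<q x+q≤y = ℚ.≤-trans (ℚ.≤-reflexive (sym (ℚ.+-identityʳ x)))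
      (ℚ.≤-trans (ℚ.+-monoʳ-≤ x (ℚ.<⇒≤ 0<q)) x+q≤y)

theorem3p1 : ∃[ C ] (fromℕ 0 <ᵣ C ×
    (∀ (ε δ : ℝ) → fromℕ 0 <ᵣ ε → fromℕ 0 <ᵣ δ → δ <ᵣ fromℕ 1 →
    ∀ (n k : ℕ) .{{_ : NonZero k}} → C ≤ᵣ fromℕ k *ᵣ (ε *ᵣ ε *ᵣ δ) →
    ∀ (a : List (Fin n)) → WeakTracking k ε δ a))
-- 404 = 202 · 2, from `sign-count` and `collision-energy`.
theorem3p1 = fromℕ 404 , (1ℚ , ℚ.positive⁻¹ 1ℚ , 0 , λ _ _ → ι-mono-≤ {1ℤ} {+ 404} (+≤+ (ℕ.s≤s ℕ.z≤n))) , tracking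
  where
  tracking : ∀ (ε δ : ℝ) → fromℕ 0 <ᵣ ε → fromℕ 0 <ᵣ δ → δ <ᵣ fromℕ 1 →
    ∀ (n k : ℕ) .{{_ : NonZero k}} → fromℕ 404 ≤ᵣ fromℕ k *ᵣ (ε *ᵣ ε *ᵣ δ) →
    ∀ (a : List (Fin n)) → WeakTracking k ε δ a
  -- As `≤ᵣ` is a negated `<ᵣ`, the goal is a contradiction. If Pr exceeds δ by `r`, then k ε² δ
  -- eventually falls short of 404 by at least `g` = k e² r, where `e` is a positive rational
  -- eventually below ε; this refutes `large`.
  tracking ε δ (e , 0<e , N₁ , e≤ε) _ _ n k large a D? D⊆fails (r , 0<r , N₂ , δ+r≤Pr) =
    large (g , ℚ.positive⁻¹ g {{g>0}} , N₁ ℕ.⊔ (N₂ ℕ.⊔ N₃) , small)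
    where
    N₃ = proj₁ (eventually-fails ε a D? D⊆fails)
    K : ℚ
    K = ι (+ k)
    K>0 : ℚ.Positive K
    K>0 = ι-positive k
    g : ℚ
    g = K ℚ.* (e ℚ.* e ℚ.* r)
    ee>0 : ℚ.Positive (e ℚ.* e)
    ee>0 = ℚ.pos*pos⇒pos e {{ℚ.positive 0<e}} e {{ℚ.positive 0<e}}
    g>0 : ℚ.Positive g
    g>0 = ℚ.pos*pos⇒pos K {{K>0}} (e ℚ.* e ℚ.* r)
      {{ℚ.pos*pos⇒pos (e ℚ.* e) {{ee>0}} r {{ℚ.positive 0<r}}}}
    collect : ∀ K x d r → K ℚ.* (x ℚ.* d) ℚ.+ K ℚ.* (x ℚ.* r) ≡ K ℚ.* (x ℚ.* (d ℚ.+ r))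
    collect = solve 4 (λ K x d r → K :* (x :* d) :+ K :* (x :* r) := K :* (x :* (d :+ r))) refl
      where open +-*-Solver
    small : ∀ i → N₁ ℕ.⊔ (N₂ ℕ.⊔ N₃) ℕ.≤ i →
      K ℚ.* (seq ε i ℚ.* seq ε i ℚ.* seq δ i) ℚ.+ g ℚ.≤ ι (+ 404)
    small i N≤i = begin
      K ℚ.* (x ℚ.* x ℚ.* seq δ i) ℚ.+ K ℚ.* (e ℚ.* e ℚ.* r)
        ≤⟨ ℚ.+-monoʳ-≤ (K ℚ.* (x ℚ.* x ℚ.* seq δ i))
             (ℚ.*-monoˡ-≤-nonNeg K {{ℚ.pos⇒nonNeg K {{K>0}}}}
               (ℚ.*-monoʳ-≤-nonNeg r {{ℚ.pos⇒nonNeg r {{ℚ.positive 0<r}}}} ee≤xx)) ⟩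
      K ℚ.* (x ℚ.* x ℚ.* seq δ i) ℚ.+ K ℚ.* (x ℚ.* x ℚ.* r)
        ≡⟨ collect K (x ℚ.* x) (seq δ i) r ⟩
      K ℚ.* (x ℚ.* x ℚ.* (seq δ i ℚ.+ r))
        ≤⟨ ℚ.*-monoˡ-≤-nonNeg K {{ℚ.pos⇒nonNeg K {{K>0}}}}
             (ℚ.*-monoˡ-≤-nonNeg (x ℚ.* x) {{ℚ.nonNegative (ℚ.≤-trans 0≤ee ee≤xx)}} (δ+r≤Pr i N₂≤i)) ⟩
      K ℚ.* (x ℚ.* x ℚ.* Pr D?)
        ≤⟨ failure-probability x 0≤x a D? (proj₂ (eventually-fails ε a D? D⊆fails) i N₃≤i) ⟩
      ι (+ 404) ∎
      where
      open ℚ.≤-Reasoning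
      x = seq ε i
      N₁≤i = ℕ.≤-trans (ℕ.m≤m⊔n N₁ (N₂ ℕ.⊔ N₃)) N≤i
      N₂≤i = ℕ.≤-trans (ℕ.m≤m⊔n N₂ N₃) (ℕ.≤-trans (ℕ.m≤n⊔m N₁ (N₂ ℕ.⊔ N₃)) N≤i)
      N₃≤i = ℕ.≤-trans (ℕ.m≤n⊔m N₂ N₃) (ℕ.≤-trans (ℕ.m≤n⊔m N₁ (N₂ ℕ.⊔ N₃)) N≤i)
      e≤x : e ℚ.≤ x
      e≤x = ℚ.≤-trans (ℚ.≤-reflexive (sym (ℚ.+-identityˡ e))) (e≤ε i N₁≤i)
      0≤x : 0ℚ ℚ.≤ x
      0≤x = ℚ.≤-trans (ℚ.<⇒≤ 0<e) e≤x
      0≤ee : 0ℚ ℚ.≤ e ℚ.* e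
      0≤ee = ℚ.<⇒≤ (ℚ.positive⁻¹ (e ℚ.* e) {{ee>0}})
      ee≤xx : e ℚ.* e ℚ.≤ x ℚ.* x
      ee≤xx = ℚ.≤-trans
        (ℚ.*-monoˡ-≤-nonNeg e {{ℚ.nonNegative (ℚ.<⇒≤ 0<e)}} e≤x)
        (ℚ.*-monoʳ-≤-nonNeg x {{ℚ.nonNegative 0≤x}} e≤x)
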